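{- Let $n \geq 5000$ and let $G$ and $H$ be graphs on $n$ vertices such that $G$ is a forest and $G$ and $H$ have at least $\lfloor n/2\rfloor + 2$ common cards. Then $H$ is a forest. (Equivalently: for $n\ge 5000$, whether a graph on $n$ vertices is a forest can be determined from any $\lfloor n/2\rfloor+2$ of its cards.)
   Context: All graphs are finite and simple. For a graph $X$ and a vertex $v$, the card $X-v$ is the unlabeled graph obtained by deleting $v$ and its incident edges; the deck of $X$ is the multiset $\{X-v : v\in V(X)\}$. The number of common cards of two graphs $X,Y$ on the same number of vertices is the size of the multiset intersection of their decks, i.e. the largest $m$ such that there are distinct vertices $x_1,\dots,x_m$ of $X$ and distinct vertices $y_1,\dots,y_m$ of $Y$ with $X-x_i\cong Y-y_i$ for all $i$. -}

module Defs where

open import Data.Nat using (ℕ; suc)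
open import Data.Bool using (Bool; true; false)
open import Data.Fin using (Fin; zero; suc; inject₁; fromℕ; punchIn)
open import Data.Product using (Σ; _×_; ∃)
open import Function.Definitions using (Injective)
open import Function.Bundles using (_↔_; Inverse)
open import Relation.Binary.PropositionalEquality using (_≡_)
open import Relation.Nullary using (¬_)

record Graph (n : ℕ) : Set where
  field
    adj   : Fin n → Fin n → Bool
    sym   : ∀ i j → adj i j ≡ adj j i
    irrefl : ∀ i → adj i i ≡ false
open Graph public

_≅_ : ∀ {n} → Graph n → Graph n → Set
_≅_ {n} X Y = Σ (Fin n ↔ Fin n) λ f →
  ∀ i j → adj Y (Inverse.to f i) (Inverse.to f j) ≡ adj X i j

card : ∀ {m} → Graph (suc m) → Fin (suc m) → Graph m
card X v = record
  { adj    = λ i j → adj X (punchIn v i) (punchIn v j)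
  ; sym    = λ i j → sym X (punchIn v i) (punchIn v j)
  ; irrefl = λ i → irrefl X (punchIn v i)
  }

AtLeastCommonCards : ∀ {m} → ℕ → Graph (suc m) → Graph (suc m) → Set
AtLeastCommonCards {m} k X Y =
  Σ (Fin k → Fin (suc m)) λ x →
  Σ (Fin k → Fin (suc m)) λ y →
    Injective _≡_ _≡_ x × Injective _≡_ _≡_ y ×
    (∀ i → card X (x i) ≅ card Y (y i))

record Cycle {n : ℕ} (X : Graph n) : Set where
  field
    len    : ℕ
    vtx    : Fin (suc (suc (suc len))) → Fin n
    inj    : Injective _≡_ _≡_ vtx
    step   : ∀ (i : Fin (suc (suc len))) → adj X (vtx (inject₁ i)) (vtx (suc i)) ≡ true
    close  : adj X (vtx (fromℕ (suc (suc len)))) (vtx zero) ≡ true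

IsForest : ∀ {n} → Graph n → Set
IsForest X = ¬ Cycle X

{-# OPTIONS --safe #-}
-- Suppose that H has a cycle C, of length L. The cards H − y i are forests, so
-- C contains all the y i, L ≥ k > n/2, and each vertex in the component of C
-- hangs on exactly one vertex of C. Let W u count the vertices hanging on u,
-- with u itself, and let h be the sum of the W u. The large component of H − y i has
-- h − W (y i) vertices and contains the path C − y i; through the isomorphism
-- of cards G − x i has such a component B i with a path P i of L − 1 vertices. All
-- B i lie in one component G₀ of G, with g vertices.
--
-- If g < h, then W (y i) ≥ h − g, with strict inequality when x i is in G₀, and
-- summing over i gives 2k ≤ n + 1. Otherwise the pieces X i = G₀ ∖ B i have
-- W (y i) + g − h vertices and form a laminar family, and since G is a forest at
-- most two of the x j on a path P i share the same W (y j). On the other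
-- hand at least k + L − n − 1 of the x j lie on P i. If g > h, each X i contains
-- a vertex that is no x j, which leaves too little room off P i.
--
-- If g = h, let M be the maximal W, attained at a landmark on C. At most 2M of the x j
-- lie on P i, so L − k < 2M, and W (y j) = M for at most two j. In G the
-- landmark of card i sits at a vertex z i. Different z i carry disjoint pieces of M
-- vertices, while the sizes of the two sides of z i determine i up to
-- boundedly many choices; hence at most 16 i share a z i, and M is bounded.
-- In one fixed reference card, the vertices z i become vertices of C with W = M,
-- and there are at most L − k + 2 of those: too few for all the i.
module Submission where

open import Defs renaming (sym to adj-sym)
open import Data.Bool using (true)
open import Data.Empty using (⊥; ⊥-elim)
open import Data.Fin using (Fin; zero; suc; toℕ; inject₁; fromℕ; fromℕ<; punchIn)
open import Data.Fin.Permutation using (Permutation′; _⟨$⟩ʳ_; _⟨$⟩ˡ_; inverseˡ; inverseʳ; insert; insert-punchIn)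
import Data.Fin.Properties as Fin
open import Data.List using (List; []; _∷_; length; lookup)
open import Data.List.Membership.Propositional using (_∈_; _∉_)
open import Data.List.Membership.Propositional.Properties using (∈-lookup)
open import Data.List.Relation.Unary.Any using (here; there; any?)
open import Data.Nat using (ℕ; zero; suc; pred; _+_; _*_; _∸_; _/_; _%_; _≤_; _<_; z≤n; s≤s; >-nonZero)
open import Data.Nat.Divisibility using (_∣_; divides; ∣m+n∣m⇒∣n; ∣⇒≤)
open import Data.Nat.DivMod using (m%n<n; m<n⇒m%n≡m; n%n≡0; [m+n]%n≡m%n; %-distribˡ-+; m≡m%n+[m/n]*n; /-monoˡ-≤)
open import Data.Nat.Properties
open import Data.Nat.Tactic.RingSolver using (solve-∀)
open import Data.Product using (∃; _×_; _,_; proj₁; proj₂)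
open import Data.Sum using (_⊎_; inj₁; inj₂; [_,_]′)
open import Data.Unit using (⊤; tt)
open import Function using (_∘_; id)
open import Function.Definitions using (Injective)
open import Relation.Binary.Definitions using (tri<; tri≈; tri>)
open import Relation.Binary.PropositionalEquality using (_≡_; _≢_; refl; sym; trans; cong; cong₂; subst; subst₂)
open import Relation.Nullary using (¬_; Dec; yes; no)
open import Relation.Nullary.Decidable using (_×-dec_; _⊎-dec_; ¬?; from-yes)
open import Relation.Unary using (Decidable)
open import Algebra.Properties.CommutativeMonoid.Sum +-0-commutativeMonoid using (sum; ∑-comm; ∑-distrib-+; sum-permute)

-- Counting

private
  variable
    m n : ℕ

ind : {A : Set} → Dec A → ℕ
ind (yes _) = 1
ind (no  _) = 0

ind-yes : {A : Set} (d : Dec A) → A → ind d ≡ 1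
ind-yes (yes _) _ = refl
ind-yes (no ¬a) a = ⊥-elim (¬a a)

ind-no : {A : Set} (d : Dec A) → ¬ A → ind d ≡ 0
ind-no (yes a) ¬a = ⊥-elim (¬a a)
ind-no (no _)  _  = refl

ind-mono : {A B : Set} (d : Dec A) (e : Dec B) → (A → B) → ind d ≤ ind e
ind-mono (no _)  e f = z≤n
ind-mono (yes a) e f = ≤-reflexive (sym (ind-yes e (f a)))

# : {P : Fin n → Set} → Decidable P → ℕ
# P? = sum λ i → ind (P? i)

sum-mono : {f g : Fin n → ℕ} → (∀ i → f i ≤ g i) → sum f ≤ sum g
sum-mono {zero}  h = z≤n
sum-mono {suc n} h = +-mono-≤ (h zero) (sum-mono (h ∘ suc))

sum-≤ : (f : Fin n → ℕ) {b : ℕ} → (∀ i → f i ≤ b) → sum f ≤ n * b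
sum-≤ {zero}  f h = z≤n
sum-≤ {suc n} f h = +-mono-≤ (h zero) (sum-≤ (f ∘ suc) (h ∘ suc))

sum-≥ : (f : Fin n → ℕ) {b : ℕ} → (∀ i → b ≤ f i) → n * b ≤ sum f
sum-≥ {zero}  f h = z≤n
sum-≥ {suc n} f h = +-mono-≤ (h zero) (sum-≥ (f ∘ suc) (h ∘ suc))

sum-*ˡ : (f : Fin n → ℕ) (b : ℕ) → sum (λ i → f i * b) ≡ sum f * b
sum-*ˡ {zero}  f b = refl
sum-*ˡ {suc n} f b = trans (cong (f zero * b +_) (sum-*ˡ (f ∘ suc) b)) (sym (*-distribʳ-+ b (f zero) _))

term≤sum : (f : Fin n → ℕ) (i : Fin n) → f i ≤ sum f
term≤sum f zero    = m≤m+n _ _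
term≤sum f (suc i) = ≤-trans (term≤sum (f ∘ suc) i) (m≤n+m _ _)

module _ {P Q : Fin n → Set} (P? : Decidable P) (Q? : Decidable Q) where

  #-mono : (∀ {i} → P i → Q i) → # P? ≤ # Q?
  #-mono f = sum-mono λ i → ind-mono (P? i) (Q? i) f

  #-< : (∀ {i} → P i → Q i) → ∀ i → ¬ P i → Q i → # P? < # Q?
  #-< f i ¬p q = go f i ¬p q
    where
    go : ∀ {m} {P Q : Fin m → Set} {P? : Decidable P} {Q? : Decidable Q} →
         (∀ {i} → P i → Q i) → ∀ i → ¬ P i → Q i → # P? < # Q?
    go {P? = P?} {Q?} f zero ¬p q rewrite ind-no (P? zero) ¬p | ind-yes (Q? zero) q =
      s≤s (sum-mono λ i → ind-mono (P? (suc i)) (Q? (suc i)) f)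
    go {P? = P?} {Q?} f (suc i) ¬p q =
      +-mono-≤-< (ind-mono (P? zero) (Q? zero) f) (go {P? = P? ∘ suc} {Q? ∘ suc} f i ¬p q)

#-≤ : {P : Fin n → Set} (P? : Decidable P) → # P? ≤ n
#-≤ {n} P? = ≤-trans (sum-≤ _ (λ i → ind≤1 (P? i))) (≤-reflexive (*-identityʳ n))
  where
  ind≤1 : {A : Set} (d : Dec A) → ind d ≤ 1
  ind≤1 (yes _) = s≤s z≤n
  ind≤1 (no _)  = z≤n

#-all : {P : Fin n → Set} (P? : Decidable P) → (∀ i → P i) → n ≤ # P?
#-all {n} P? p = ≤-trans (≤-reflexive (sym (*-identityʳ n)))
                   (sum-≥ _ λ i → ≤-reflexive (sym (ind-yes (P? i) (p i))))

module _ {P Q R : Fin n → Set} (P? : Decidable P) (Q? : Decidable Q) (R? : Decidable R) where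

  #-cover : (∀ {i} → R i → P i ⊎ Q i) → # R? ≤ # P? + # Q?
  #-cover f = ≤-trans (sum-mono λ i → go (P? i) (Q? i) (R? i) f) (≤-reflexive (∑-distrib-+ (ind ∘ P?) (ind ∘ Q?)))
    where
    go : {A B C : Set} (a : Dec A) (b : Dec B) (c : Dec C) → (C → A ⊎ B) → ind c ≤ ind a + ind b
    go a b (no _) f = z≤n
    go a b (yes c) f with f c
    ... | inj₁ x rewrite ind-yes a x = s≤s z≤n
    ... | inj₂ y rewrite ind-yes b y = m≤n+m 1 (ind a)

  #-disjoint : (∀ {i} → P i → R i) → (∀ {i} → Q i → R i) → (∀ {i} → P i → Q i → ⊥) → # P? + # Q? ≤ # R?
  #-disjoint f g h = ≤-trans (≤-reflexive (sym (∑-distrib-+ (ind ∘ P?) (ind ∘ Q?)))) (sum-mono λ i → go (P? i) (Q? i) (R? i) f g h)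
    where
    go : {A B C : Set} (a : Dec A) (b : Dec B) (c : Dec C) → (A → C) → (B → C) → (A → B → ⊥) → ind a + ind b ≤ ind c
    go (yes x) (yes y) c f g h = ⊥-elim (h x y)
    go (yes x) (no _)  c f g h = ≤-reflexive (sym (ind-yes c (f x)))
    go (no _)  b       c f g h = ind-mono b c g

#-witness : {P : Fin n → Set} (P? : Decidable P) → 0 < # P? → ∃ P
#-witness {suc n} P? h with P? zero
... | yes p = zero , p
... | no _ with i , p ← #-witness (P? ∘ suc) h = suc i , p

#-≤1 : {P : Fin n → Set} (P? : Decidable P) → (∀ {i j} → P i → P j → i ≡ j) → # P? ≤ 1
#-≤1 {zero}  P? u = z≤n
#-≤1 {suc n} P? u with P? zero
... | no _  = #-≤1 (P? ∘ suc) λ p q → Fin.suc-injective (u p q)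
... | yes p = s≤s (≤-trans (sum-≤ _ {0} λ i → ≤-reflexive (ind-no (P? (suc i)) λ q → absurd (u p q))) (≤-reflexive (*-zeroʳ n)))
  where
  absurd : ∀ {i : Fin n} → zero ≡ suc i → ⊥
  absurd ()

#-remove : {P : Fin n → Set} (P? : Decidable P) (j : Fin n) →
           # P? ≤ 1 + # (λ i → P? i ×-dec ¬? (i Fin.≟ j))
#-remove P? j = ≤-trans
  (#-cover (Fin._≟ j) (λ i → P? i ×-dec ¬? (i Fin.≟ j)) P? split)
  (+-monoˡ-≤ _ (#-≤1 (Fin._≟ j) λ p q → trans p (sym q)))
  where
  split : ∀ {i} → _ → i ≡ j ⊎ _
  split {i} p with i Fin.≟ j
  ... | yes e = inj₁ e
  ... | no ¬e = inj₂ (p , ¬e)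

#-≤2 : {P : Fin n → Set} (P? : Decidable P) →
       (∀ {i j l} → P i → P j → P l → i ≢ j → j ≢ l → i ≢ l → ⊥) → # P? ≤ 2
#-≤2 {P = P} P? bad = ≮⇒≥ λ h → pick₃ h
  where
  pick₃ : 2 < # P? → ⊥
  pick₃ h with i , pi ← #-witness P? (≤-trans (s≤s z≤n) h)
    with j , pj , j≢i ← #-witness (λ l → P? l ×-dec ¬? (l Fin.≟ i))
                          (≤-trans (s≤s z≤n) (+-cancelˡ-≤ 1 _ _ (≤-trans h (#-remove P? i))))
    with l , (pl , l≢i) , l≢j ← #-witness (λ l → (P? l ×-dec ¬? (l Fin.≟ i)) ×-dec ¬? (l Fin.≟ j))
           (+-cancelˡ-≤ 2 _ _ (≤-trans h (≤-trans (#-remove P? i)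
              (+-monoʳ-≤ 1 (#-remove (λ l → P? l ×-dec ¬? (l Fin.≟ i)) j)))))
    = bad pi pj pl (j≢i ∘ sym) (l≢j ∘ sym) (l≢i ∘ sym)

-- It is enough to exclude three elements in increasing order of an injective key. The keys will be
-- positions along the cycle.
sort₃ : {P : Fin n → Set} (key : Fin n → ℕ) →
        (∀ {i j} → P i → P j → key i ≡ key j → i ≡ j) →
        (∀ {i j l} → P i → P j → P l → key i < key j → key j < key l → ⊥) →
        ∀ {i j l} → P i → P j → P l → i ≢ j → j ≢ l → i ≢ l → ⊥
sort₃ key inj bad {i} {j} {l} pi pj pl i≢j j≢l i≢l
  with <-cmp (key i) (key j) | <-cmp (key j) (key l) | <-cmp (key i) (key l)
... | tri≈ _ e _ | _          | _          = i≢j (inj pi pj e)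
... | tri< _ _ _ | tri≈ _ e _ | _          = j≢l (inj pj pl e)
... | tri> _ _ _ | tri≈ _ e _ | _          = j≢l (inj pj pl e)
... | tri< _ _ _ | tri> _ _ _ | tri≈ _ e _ = i≢l (inj pi pl e)
... | tri> _ _ _ | tri< _ _ _ | tri≈ _ e _ = i≢l (inj pi pl e)
... | tri< a _ _ | tri< b _ _ | _          = bad pi pj pl a b
... | tri> _ _ a | tri> _ _ b | _          = bad pl pj pi b a
... | tri< a _ _ | tri> _ _ b | tri< c _ _ = bad pi pl pj c b
... | tri< a _ _ | tri> _ _ b | tri> _ _ c = bad pl pi pj c a
... | tri> _ _ a | tri< b _ _ | tri< c _ _ = bad pj pi pl a c
... | tri> _ _ a | tri< b _ _ | tri> _ _ c = bad pj pl pi b c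

#-∑-comm : {R : Fin m → Fin n → Set} (R? : ∀ i v → Dec (R i v)) →
           sum (λ i → # (R? i)) ≡ sum (λ v → # (λ i → R? i v))
#-∑-comm R? = ∑-comm λ i v → ind (R? i v)

-- The columns of `R` over `Q` cover the rows in `P`. A relation is used instead of a function, so
-- an element may lie in several fibres.
#-fibres : ∀ {m n} {P : Fin m → Set} {Q : Fin n → Set} {R : Fin m → Fin n → Set}
           (P? : Decidable P) (Q? : Decidable Q) (R? : ∀ i t → Dec (R i t)) {b : ℕ} →
           (∀ {i} → P i → ∃ λ t → Q t × R i t) →
           (∀ {t} → Q t → # (λ i → P? i ×-dec R? i t) ≤ b) → # P? ≤ # Q? * b
#-fibres {m} {P = P} {Q} {R} P? Q? R? {b} cov fib = begin
  # P?                                                           ≤⟨ sum-mono row ⟩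
  sum (λ i → # (λ t → Q? t ×-dec (P? i ×-dec R? i t)))
    ≡⟨ #-∑-comm (λ i t → Q? t ×-dec (P? i ×-dec R? i t)) ⟩
  sum (λ t → # (λ i → Q? t ×-dec (P? i ×-dec R? i t)))           ≤⟨ sum-mono col ⟩
  sum (λ t → ind (Q? t) * b)                                     ≡⟨ sum-*ˡ (λ t → ind (Q? t)) b ⟩
  # Q? * b                                                       ∎
  where
  open ≤-Reasoning
  row : ∀ i → ind (P? i) ≤ # (λ t → Q? t ×-dec (P? i ×-dec R? i t))
  row i with P? i
  ... | no _ = z≤n
  ... | yes p with t , q , r ← cov p = ≤-trans
    (≤-reflexive (sym (ind-yes (Q? t ×-dec (yes p ×-dec R? i t)) (q , p , r))))
    (term≤sum (λ t → ind (Q? t ×-dec (yes p ×-dec R? i t))) t)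
  col : ∀ t → # (λ i → Q? t ×-dec (P? i ×-dec R? i t)) ≤ ind (Q? t) * b
  col t with Q? t
  ... | yes q = ≤-trans (#-mono (λ i → yes q ×-dec (P? i ×-dec R? i t)) (λ i → P? i ×-dec R? i t) proj₂)
                  (≤-trans (fib q) (≤-reflexive (sym (+-identityʳ b))))
  ... | no ¬q = ≤-trans (sum-≤ _ {0} λ i → ≤-reflexive (ind-no (no ¬q ×-dec (P? i ×-dec R? i t)) (¬q ∘ proj₁)))
                  (≤-reflexive (*-zeroʳ m))

-- Double counting of the incidences, by rows on the left and by columns on the right.
#-double : {P : Fin m → Set} {R : Fin m → Fin n → Set} (P? : Decidable P) (R? : ∀ i v → Dec (R i v)) {s b : ℕ} →
           (∀ {i} → P i → s ≤ # (R? i)) → (∀ v → # (λ i → P? i ×-dec R? i v) ≤ b) → # P? * s ≤ n * b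
#-double {P = P} {R} P? R? {s} {b} big few = begin
  # P? * s                                      ≡⟨ sym (sum-*ˡ (λ i → ind (P? i)) s) ⟩
  sum (λ i → ind (P? i) * s)                    ≤⟨ sum-mono row ⟩
  sum (λ i → # (λ v → P? i ×-dec R? i v))       ≡⟨ #-∑-comm (λ i v → P? i ×-dec R? i v) ⟩
  sum (λ v → # (λ i → P? i ×-dec R? i v))       ≤⟨ sum-≤ _ few ⟩
  _                                             ∎
  where
  open ≤-Reasoning
  row : ∀ i → ind (P? i) * s ≤ # (λ v → P? i ×-dec R? i v)
  row i with P? i
  ... | no _ = z≤n
  ... | yes p = ≤-trans (≤-reflexive (+-identityʳ s)) (≤-trans (big p)
                  (#-mono (R? i) (λ v → yes p ×-dec R? i v) (p ,_)))

#-injective : {P : Fin m → Set} {Q : Fin n → Set} (P? : Decidable P) (Q? : Decidable Q) (f : Fin m → Fin n) →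
              (∀ {i} → P i → Q (f i)) → (∀ {i j} → P i → P j → f i ≡ f j → i ≡ j) → # P? ≤ # Q?
#-injective P? Q? f pq inj = ≤-trans
  (#-fibres P? Q? (λ i t → f i Fin.≟ t) (λ p → f _ , pq p , refl)
    λ {t} q → #-≤1 (λ i → P? i ×-dec (f i Fin.≟ t)) λ (p , e) (p′ , e′) → inj p p′ (trans e (sym e′)))
  (≤-reflexive (*-identityʳ _))

#-meet : {P Q : Fin n → Set} (P? : Decidable P) (Q? : Decidable Q) → n < # P? + # Q? → ∃ λ i → P i × Q i
#-meet {n} P? Q? h with Fin.any? (λ i → P? i ×-dec Q? i)
... | yes w = w
... | no ¬w = ⊥-elim (<⇒≱ h (≤-trans (#-disjoint P? Q? all _ _ λ p q → ¬w (_ , p , q)) (#-≤ all)))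
  where
  all : Decidable {A = Fin n} (λ _ → ⊤)
  all _ = yes tt

#-dichotomy : {P : Fin n → Set} (P? : Decidable P) → n ≤ # P? + # (λ i → ¬? (P? i))
#-dichotomy {n} {P} P? = ≤-trans (#-all {P = λ _ → ⊤} all _) (#-cover P? (λ i → ¬? (P? i)) all λ {i} _ → split (P? i))
  where
  all : Decidable {A = Fin n} (λ _ → ⊤)
  all _ = yes tt
  split : ∀ {i} → Dec (P i) → P i ⊎ ¬ P i
  split (yes p) = inj₁ p
  split (no ¬p) = inj₂ ¬p

sum-const : ∀ n (b : ℕ) → sum {n} (λ _ → b) ≡ n * b
sum-const zero    b = refl
sum-const (suc n) b = cong (b +_) (sum-const n b)

#-permute : {P : Fin n → Set} (P? : Decidable P) (π : Permutation′ n) → # P? ≡ # (λ v → P? (π ⟨$⟩ʳ v))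
#-permute P? π = sum-permute (λ i → ind (P? i)) π

-- Over a finite index double negation commutes with the quantifier. Together with `¬¬-Dec` this
-- makes a predicate decidable at all vertices at once while a negative goal is being proved.
¬¬-∀ : {A : Fin n → Set} → (∀ i → ¬ ¬ A i) → ¬ ¬ (∀ i → A i)
¬¬-∀ {zero}  h c = c λ ()
¬¬-∀ {suc n} h c = h zero λ a → ¬¬-∀ (h ∘ suc) λ g → c λ { zero → a ; (suc i) → g i }

¬¬-Dec : {A : Set} → ¬ ¬ Dec A
¬¬-Dec c = c (no λ a → c (yes a))

argmax : 0 < n → (f : Fin n → ℕ) → ∃ λ i → ∀ j → f j ≤ f i
argmax {suc zero}    _ f = zero , λ { zero → ≤-refl }
argmax {suc (suc n)} _ f with i , h ← argmax (s≤s z≤n) (f ∘ suc) with ≤-total (f zero) (f (suc i))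
... | inj₁ p = suc i , λ { zero → p ; (suc j) → h j }
... | inj₂ p = zero , λ { zero → ≤-refl ; (suc j) → ≤-trans (h j) p }

-- Walks and forests

data Walk (X : Graph n) (P : Fin n → Set) : Fin n → Fin n → Set where
  done : ∀ {u} → P u → Walk X P u u
  step : ∀ {u w v} → P u → adj X u w ≡ true → Walk X P w v → Walk X P u v

module _ {X : Graph n} where

  flip-adj : ∀ {u w} → adj X u w ≡ true → adj X w u ≡ true
  flip-adj {u} {w} e = trans (adj-sym X w u) e

  module _ {P : Fin n → Set} where

    infixr 5 _++_
    _++_ : ∀ {u w v} → Walk X P u w → Walk X P w v → Walk X P u v
    done _     ++ q = q
    step p e r ++ q = step p e (r ++ q)

    walk-head : ∀ {u v} → Walk X P u v → P u
    walk-head (done p)     = p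
    walk-head (step p _ _) = p

    walk-last : ∀ {u v} → Walk X P u v → P v
    walk-last (done p)     = p
    walk-last (step _ _ r) = walk-last r

    snoc : ∀ {u w v} → Walk X P u w → adj X w v ≡ true → P v → Walk X P u v
    snoc r e p = r ++ step (walk-last r) e (done p)

    reverse : ∀ {u v} → Walk X P u v → Walk X P v u
    reverse (done p)     = done p
    reverse (step p e r) = snoc (reverse r) (flip-adj e) p

  walk-map : {P Q : Fin n → Set} → (∀ {w} → P w → Q w) → ∀ {u v} → Walk X P u v → Walk X Q u v
  walk-map f (done p)     = done (f p)
  walk-map f (step p e r) = step (f p) e (walk-map f r)

  walk-closed : {P S : Fin n → Set} → (∀ {u w} → P u → P w → adj X u w ≡ true → S u → S w) →
                ∀ {u v} → Walk X P u v → S u → Walk X (λ w → P w × S w) u v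
  walk-closed cl (done p)     s = done (p , s)
  walk-closed cl (step p e r) s = step (p , s) e (walk-closed cl r (cl p (walk-head r) e s))

module _ {X : Graph n} {P : Fin n → Set} where

  -- The walk is cut at its first visit to `z`.
  last-step : ∀ {u z} → Walk X P u z → u ≢ z → ∃ λ w → P w × w ≢ z × adj X w z ≡ true × Walk X (λ v → P v × v ≢ z) u w
  last-step (done _) ne = ⊥-elim (ne refl)
  last-step {u} {z} (step {w = w} p e r) ne with w Fin.≟ z
  ... | yes refl = u , p , ne , e , done (p , ne)
  ... | no w≢z with t , q , t≢z , e′ , r′ ← last-step r w≢z = t , q , t≢z , e′ , step (p , ne) e r′

  -- The walk is cut at its first visit to either vertex: whichever comes first is reached without
  -- meeting the other.
  first-hit : ∀ {u z z′} → z ≢ z′ → Walk X P u z → Walk X (_≢ z) u z′ ⊎ Walk X (_≢ z′) u z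
  first-hit z≢ (done _) = inj₂ (done z≢)
  first-hit {u} {z} {z′} z≢ (step p e r) with u Fin.≟ z | u Fin.≟ z′
  ... | yes refl | _ = inj₂ (done z≢)
  ... | no _ | yes refl = inj₁ (done (z≢ ∘ sym))
  ... | no u≢z | no u≢z′ with first-hit z≢ r
  ...   | inj₁ r′ = inj₁ (step u≢z e r′)
  ...   | inj₂ r′ = inj₂ (step u≢z′ e r′)

walk-image : {X : Graph n} {Y : Graph n} {P Q : Fin n → Set} (f : Fin n → Fin n) →
             (∀ {u} → P u → Q (f u)) →
             (∀ {u w} → P u → P w → adj X u w ≡ true → adj Y (f u) (f w) ≡ true) →
             ∀ {u v} → Walk X P u v → Walk Y Q (f u) (f v)
walk-image f pq h (done p)     = done (pq p)
walk-image f pq h (step p e r) = step (pq p) (h p (walk-head r) e) (walk-image f pq h r)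

data SimplePath (X : Graph n) : Fin n → Fin n → List (Fin n) → Set where
  one  : ∀ {u} → SimplePath X u u (u ∷ [])
  cons : ∀ {u w v l} → u ∉ l → adj X u w ≡ true → SimplePath X w v l → SimplePath X u v (u ∷ l)

module _ {X : Graph n} where

  suffix : ∀ {u w v l} → SimplePath X w v l → u ∈ l →
           ∃ λ l′ → SimplePath X u v l′ × (∀ {t} → t ∈ l′ → t ∈ l)
  suffix one            (here refl) = _ , one , id
  suffix (cons ∉ e s)   (here refl) = _ , cons ∉ e s , id
  suffix (cons ∉ e s)   (there i) with l′ , s′ , sub ← suffix s i = l′ , s′ , there ∘ sub

  simplify : {P : Fin n → Set} → ∀ {u v} → Walk X P u v →
             ∃ λ l → SimplePath X u v l × (∀ {t} → t ∈ l → P t)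
  simplify (done p) = _ , one , λ { (here refl) → p }
  simplify (step {u} p e r) with l , s , all ← simplify r with any? (u Fin.≟_) l
  ... | yes i with l′ , s′ , sub ← suffix s i = l′ , s′ , all ∘ sub
  ... | no ¬i = u ∷ l , cons ¬i e s , λ { (here refl) → p ; (there i) → all i }

  simple-injective : ∀ {u v l} → SimplePath X u v l → Injective _≡_ _≡_ (lookup l)
  simple-injective one          {zero}  {zero}  _ = refl
  simple-injective (cons ∉ e s) {zero}  {zero}  _ = refl
  simple-injective (cons ∉ e s) {zero}  {suc j} h = ⊥-elim (∉ (subst (_∈ _) (sym h) (∈-lookup j)))
  simple-injective (cons ∉ e s) {suc i} {zero}  h = ⊥-elim (∉ (subst (_∈ _) h (∈-lookup i)))
  simple-injective (cons ∉ e s) {suc i} {suc j} h = cong suc (simple-injective s h)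

  simple-head : ∀ {u v t l} → SimplePath X u v (t ∷ l) → t ≡ u
  simple-head one          = refl
  simple-head (cons _ _ _) = refl

  simple-step : ∀ {u v t l} → SimplePath X u v (t ∷ l) → (i : Fin (length l)) →
                adj X (lookup (t ∷ l) (inject₁ i)) (lookup (t ∷ l) (suc i)) ≡ true
  simple-step (cons {l = _ ∷ _} ∉ e s) zero = subst (λ t → adj X _ t ≡ true) (sym (simple-head s)) e
  simple-step (cons {l = _ ∷ _} ∉ e s) (suc i) = simple-step s i

  simple-last : ∀ {u v t l} → SimplePath X u v (t ∷ l) → lookup (t ∷ l) (fromℕ (length l)) ≡ v
  simple-last one = refl
  simple-last (cons {l = _ ∷ _} ∉ e s) = simple-last s

  -- Such a walk, made simple, closes up through `z`. As `a` and `b` differ it has at least two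
  -- vertices, so the result is a genuine cycle.
  forest-separates : IsForest X → ∀ {z a b} → adj X z a ≡ true → adj X z b ≡ true → a ≢ b →
                     ¬ Walk X (_≢ z) a b
  forest-separates forest {z} za zb a≢b r with simplify r
  ... | _ , one , _ = a≢b refl
  ... | _ ∷ [] , cons _ _ () , _
  ... | a ∷ w ∷ l , s , all = forest record
    { len   = length l
    ; vtx   = lookup (z ∷ a ∷ w ∷ l)
    ; inj   = simple-injective s′
    ; step  = simple-step s′
    ; close = trans (cong (λ t → adj X t z) (simple-last s′)) (flip-adj {X = X} zb)
    }
    where
    s′ : SimplePath X z _ (z ∷ a ∷ w ∷ l)
    s′ = cons (λ i → all i refl) za s

-- The cycle of H

-- A cycle as a periodic function on ℕ, so that it can be cut open anywhere.
record ClosedWalk {n : ℕ} (X : Graph n) : Set₁ where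
  field
    L        : ℕ
    c        : ℕ → Fin n
    C        : Fin n → Set
    C?       : Decidable C
    2<L      : 2 < L
    c-adj    : ∀ t → adj X (c t) (c (suc t)) ≡ true
    c-in     : ∀ t → C (c t)
    c-inj    : ∀ s {d} → 0 < d → d < L → c s ≢ c (s + d)
    c-period : ∀ t → c (t + L) ≡ c t
    c-window : ∀ s {v} → C v → ∃ λ d → d < L × c (s + d) ≡ v

  arc : ∀ {P : Fin n → Set} s d → (∀ r → r ≤ d → P (c (s + r))) → Walk X P (c s) (c (s + d))
  arc {P} s zero    h rewrite +-identityʳ s = done (subst (P ∘ c) (+-identityʳ s) (h 0 z≤n))
  arc s (suc d) h = snoc (arc s d (λ r r≤d → h r (m≤n⇒m≤1+n r≤d)))
    (subst (λ t → adj X (c (s + d)) (c t) ≡ true) (sym (+-suc s d)) (c-adj (s + d))) (h (suc d) ≤-refl)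

  c-distinct : ∀ s {d e} → d < L → e < L → c (s + d) ≡ c (s + e) → d ≡ e
  c-distinct s {d} {e} d<L e<L eq with <-cmp d e
  ... | tri≈ _ p _ = p
  ... | tri< d<e _ _ = ⊥-elim (c-inj (s + d) (m<n⇒0<n∸m d<e) (≤-<-trans (m∸n≤m e d) e<L)
        (trans eq (cong c (trans (cong (s +_) (sym (m+[n∸m]≡n (<⇒≤ d<e)))) (sym (+-assoc s d (e ∸ d)))))))
  ... | tri> _ _ e<d = ⊥-elim (c-inj (s + e) (m<n⇒0<n∸m e<d) (≤-<-trans (m∸n≤m d e) d<L)
        (trans (sym eq) (cong c (trans (cong (s +_) (sym (m+[n∸m]≡n (<⇒≤ e<d)))) (sym (+-assoc s e (d ∸ e)))))))

fromCycle : ∀ {n} {X : Graph n} → Cycle X → ClosedWalk X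
fromCycle {n} {X} cyc = record
  { L = L ; c = c ; C = C
  ; C? = λ v → Fin.any? λ j → vtx j Fin.≟ v
  ; 2<L = s≤s (s≤s (s≤s z≤n))
  ; c-adj = c-adj
  ; c-in = λ t → fromℕ< (m%n<n t L) , refl
  ; c-inj = c-inj
  ; c-period = c-period
  ; c-window = c-window
  }
  where
  open Cycle cyc renaming (step to edge)
  L : ℕ
  L = suc (suc (suc len))
  c : ℕ → Fin n
  c t = vtx (fromℕ< (m%n<n t L))
  C : Fin n → Set
  C v = ∃ λ j → vtx j ≡ v
  c≡ : ∀ t j → t % L ≡ toℕ j → c t ≡ vtx j
  c≡ t j e = cong vtx (Fin.toℕ-injective (trans (Fin.toℕ-fromℕ< (m%n<n t L)) e))
  c-cong : ∀ s t → s % L ≡ t % L → c s ≡ c t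
  c-cong s t e = c≡ s (fromℕ< (m%n<n t L)) (trans e (sym (Fin.toℕ-fromℕ< (m%n<n t L))))
  c-period : ∀ t → c (t + L) ≡ c t
  c-period t = c-cong (t + L) t ([m+n]%n≡m%n t L)
  suc% : ∀ t → suc t % L ≡ suc (t % L) % L
  suc% t = trans (%-distribˡ-+ 1 t L) (cong (λ r → (r + t % L) % L) (m<n⇒m%n≡m {n = L} (s≤s (s≤s z≤n))))
  c-adj : ∀ t → adj X (c t) (c (suc t)) ≡ true
  c-adj t with m≤n⇒m<n∨m≡n (m%n<n t L)
  ... | inj₁ (s≤s r<) = trans
        (cong₂ (adj X) (c≡ t (inject₁ i) (sym (trans (Fin.toℕ-inject₁ i) (Fin.toℕ-fromℕ< r<))))
          (c≡ (suc t) (suc i) (trans (suc% t) (trans (m<n⇒m%n≡m (s≤s r<)) (cong suc (sym (Fin.toℕ-fromℕ< r<)))))))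
        (edge i)
        where i = fromℕ< r<
  ... | inj₂ e = trans
        (cong₂ (adj X) (c≡ t (fromℕ _) (trans (suc-injective e) (sym (Fin.toℕ-fromℕ _))))
          (c≡ (suc t) zero (trans (suc% t) (trans (cong (_% L) e) (n%n≡0 L)))))
        close
  c-inj : ∀ s {d} → 0 < d → d < L → c s ≢ c (s + d)
  -- The two indices have the same residue, so L would divide their distance, which is positive and
  -- below L.
  c-inj s {suc d} _ d<L e = <⇒≱ d<L (∣⇒≤ (∣m+n∣m⇒∣n L∣ (divides (s / L) refl)))
    where
    same : s % L ≡ (s + suc d) % L
    same = trans (sym (Fin.toℕ-fromℕ< (m%n<n s L)))
             (trans (cong toℕ (inj e)) (Fin.toℕ-fromℕ< (m%n<n (s + suc d) L)))
    L∣ : L ∣ s / L * L + suc d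
    L∣ = divides ((s + suc d) / L) (+-cancelˡ-≡ (s % L) _ _ (trans (sym (+-assoc (s % L) _ _))
      (trans (cong (_+ suc d) (sym (m≡m%n+[m/n]*n s L)))
        (trans (m≡m%n+[m/n]*n (s + suc d) L) (cong (_+ (s + suc d) / L * L) (sym same))))))
  c-window : ∀ s {v} → C v → ∃ λ d → d < L × c (s + d) ≡ v
  c-window zero    (j , refl) = toℕ j , Fin.toℕ<n j , c≡ (toℕ j) j (m<n⇒m%n≡m (Fin.toℕ<n j))
  c-window (suc s) v∈ with c-window s v∈
  -- Moving the start of the window one step on turns offset 0 into L - 1 and lowers every other
  -- offset by one.
  ... | zero  , _ , e = suc (suc len) , ≤-refl ,
        trans (trans (cong c (sym (+-suc s _))) (c-period s)) (trans (cong c (sym (+-identityʳ s))) e)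
  ... | suc d , d<L , e = d , <-trans (n<1+n d) d<L , trans (cong c (sym (+-suc s d))) e

-- π i extends the isomorphism of the i-th common cards by x i ↦ y i.
record Cards {n : ℕ} (k : ℕ) (G H : Graph n) : Set where
  field
    x y   : Fin k → Fin n
    x-inj : Injective _≡_ _≡_ x
    y-inj : Injective _≡_ _≡_ y
    π     : Fin k → Permutation′ n
    π-x   : ∀ i → π i ⟨$⟩ʳ x i ≡ y i
    π-adj : ∀ i {u v} → u ≢ x i → v ≢ x i → adj H (π i ⟨$⟩ʳ u) (π i ⟨$⟩ʳ v) ≡ adj G u v

  to from : Fin k → Fin n → Fin n
  to   i = π i ⟨$⟩ʳ_
  from i = π i ⟨$⟩ˡ_

  to-from : ∀ i v → to i (from i v) ≡ v
  to-from i v = inverseʳ (π i)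

  from-to : ∀ i v → from i (to i v) ≡ v
  from-to i v = inverseˡ (π i)

  to-≢ : ∀ {i v} → v ≢ x i → to i v ≢ y i
  to-≢ {i} {v} ne e = ne (trans (sym (from-to i v)) (trans (cong (from i) (trans e (sym (π-x i)))) (from-to i (x i))))

  from-≢ : ∀ {i v} → v ≢ y i → from i v ≢ x i
  from-≢ {i} {v} ne e = ne (trans (sym (to-from i v)) (trans (cong (to i) e) (π-x i)))

  from-adj : ∀ i {u v} → u ≢ y i → v ≢ y i → adj H u v ≡ true → adj G (from i u) (from i v) ≡ true
  from-adj i {u} {v} u≢ v≢ e = trans (sym (π-adj i (from-≢ u≢) (from-≢ v≢)))
    (trans (cong₂ (adj H) (to-from i u) (to-from i v)) e)

  pull : ∀ i {P : Fin n → Set} → (∀ {v} → P v → v ≢ y i) →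
         ∀ {u v} → Walk H P u v → Walk G (P ∘ to i) (from i u) (from i v)
  pull i {P} h = walk-image (from i) (λ {u} p → subst P (sym (to-from i u)) p)
                   (λ pu pw e → from-adj i (h pu) (h pw) e)

  from-injective : ∀ i {u v} → from i u ≡ from i v → u ≡ v
  from-injective i {u} {v} e = trans (sym (to-from i u)) (trans (cong (to i) e) (to-from i v))

  -- Whatever avoids `y i` in H has a copy in the forest G; there the walk would contradict
  -- `forest-separates`.
  card-separates : IsForest G → ∀ i {z a b} → z ≢ y i → a ≢ y i → b ≢ y i →
                   adj H z a ≡ true → adj H z b ≡ true → a ≢ b →
                   ¬ Walk H (λ w → w ≢ z × w ≢ y i) a b
  card-separates forest i {z} z≢ a≢ b≢ za zb a≢b r =
    forest-separates forest (from-adj i z≢ a≢ za) (from-adj i z≢ b≢ zb) (a≢b ∘ from-injective i)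
      (walk-map (λ (w≢z , _) e → w≢z (trans (cong (to i) e) (to-from i z))) (pull i proj₂ r))

-- Vertices hanging on the cycle

module Roots {n k : ℕ} {G H : Graph n} (forest : IsForest G) (D : Cards k G H) (2<k : 2 < k) (cw : ClosedWalk H) where
  open Cards D
  open ClosedWalk cw

  -- A cycle that misses `y i` would survive in the card, which is a forest.
  y-in : ∀ i → C (y i)
  y-in i with C? (y i)
  ... | yes p = p
  ... | no ¬p = ⊥-elim (last 2<L c-inj c-period arc)
    where
    off : ∀ t → c t ≢ y i
    off t e = ¬p (subst C e (c-in t))
    -- The length is generalised so that it can be matched as 3 + l. Then `c 1` and `c (2 + l)` are
    -- neighbours of `c 0` joined by an arc that misses it.
    last : ∀ {ℓ} → 2 < ℓ → (∀ s {d} → 0 < d → d < ℓ → c s ≢ c (s + d)) → (∀ t → c (t + ℓ) ≡ c t) →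
           (∀ {P : Fin n → Set} s d → (∀ r → r ≤ d → P (c (s + r))) → Walk H P (c s) (c (s + d))) → ⊥
    last {suc zero} (s≤s ())
    last {suc (suc zero)} (s≤s (s≤s ()))
    last {suc (suc (suc l))} _ inj per ar =
      card-separates forest i (off 0) (off 1) (off (2 + l)) (c-adj 0)
        (flip-adj {X = H} (subst (λ t → adj H (c (2 + l)) t ≡ true) (per 0) (c-adj (2 + l))))
        (inj 1 (s≤s z≤n) (s≤s (n≤1+n (suc l))))
        (ar 1 (suc l) λ r r≤ → (λ e → inj 0 (s≤s z≤n) (s≤s (s≤s r≤)) (sym e)) , off (suc r))

  -- This is the relation of `v` hanging on `t`: the walk meets C only in its last vertex.
  data Off : Fin n → Fin n → Set where
    stop : ∀ {v} → C v → Off v v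
    step : ∀ {v w t} → ¬ C v → adj H v w ≡ true → Off w t → Off v t

  off-in : ∀ {v t} → Off v t → C t
  off-in (stop p)     = p
  off-in (step _ _ o) = off-in o

  off-walk : ∀ {v t} → Off v t → Walk H (λ w → ¬ C w ⊎ w ≡ t) v t
  off-walk (stop _)      = done (inj₂ refl)
  off-walk (step ¬p e o) = step (inj₁ ¬p) e (off-walk o)

  off-split : ∀ {v t} → ¬ C v → Off v t → ∃ λ w → ¬ C w × adj H w t ≡ true × Walk H (¬_ ∘ C) v w
  off-split ¬p (stop p) = ⊥-elim (¬p p)
  off-split ¬p (step {w = w} _ e o) with C? w
  off-split ¬p (step _ e (stop _))      | yes _ = _ , ¬p , e , done ¬p
  off-split ¬p (step _ e (step ¬q _ _)) | yes q = ⊥-elim (¬q q)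
  ... | no ¬q with u , ¬r , e′ , W ← off-split ¬q o = u , ¬r , e′ , step ¬p e W

  -- The `y i` are distinct, so two vertices exclude at most two of the more than two indices.
  spare : ∀ t t′ → ∃ λ i → y i ≢ t × y i ≢ t′
  spare t t′ = #-witness both? (+-cancelˡ-≤ 2 _ _ (≤-trans 2<k count))
    where
    both? : Decidable (λ i → y i ≢ t × y i ≢ t′)
    both? i = ¬? (y i Fin.≟ t) ×-dec ¬? (y i Fin.≟ t′)
    hit : ∀ s → # (λ i → y i Fin.≟ s) ≤ 1
    hit s = #-≤1 (λ i → y i Fin.≟ s) λ p q → y-inj (trans p (sym q))
    either? : Decidable (λ i → y i ≡ t ⊎ y i ≡ t′)
    either? i = (y i Fin.≟ t) ⊎-dec (y i Fin.≟ t′)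
    split : ∀ i → Dec (y i ≡ t) → Dec (y i ≡ t′) → (y i ≡ t ⊎ y i ≡ t′) ⊎ (y i ≢ t × y i ≢ t′)
    split i (yes p) _       = inj₁ (inj₁ p)
    split i (no _)  (yes q) = inj₁ (inj₂ q)
    split i (no p)  (no q)  = inj₂ (p , q)
    any : Decidable {A = Fin k} (λ _ → ⊤)
    any _ = yes tt
    count : k ≤ 2 + # both?
    count = begin
      k                                                                      ≤⟨ #-all any _ ⟩
      # any
        ≤⟨ #-cover either? both? any (λ {i} _ → split i (y i Fin.≟ t) (y i Fin.≟ t′)) ⟩
      # either? + # both?
        ≤⟨ +-monoˡ-≤ _ (#-cover (λ i → y i Fin.≟ t) (λ i → y i Fin.≟ t′) either? id) ⟩
      (# (λ i → y i Fin.≟ t) + # (λ i → y i Fin.≟ t′)) + # both?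
        ≤⟨ +-monoˡ-≤ _ (+-mono-≤ (hit t) (hit t′)) ⟩
      2 + # both?                                                            ∎
      where open ≤-Reasoning

  -- Otherwise the two walks from v to t and t′ close up, with the arc of the
  -- closed walk from t to t′ that avoids a deleted vertex y i, to a cycle of
  -- the forest H − y i.
  off-unique : ∀ {v t t′} → Off v t → Off v t′ → t ≡ t′
  off-unique {v} {t} {t′} o o′ with C? v | t Fin.≟ t′
  ... | _     | yes e = e
  off-unique (stop _)      (stop _)      | yes _ | no _ = refl
  off-unique (stop _)      (step ¬p _ _) | yes p | no _ = ⊥-elim (¬p p)
  off-unique (step ¬p _ _) _             | yes p | no _ = ⊥-elim (¬p p)
  off-unique {v} {t} {t′} o o′ | no ¬p | no t≢t′
    with i , yi≢t , yi≢t′ ← spare t t′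
    with w , ¬q , e , W ← off-split ¬p o
    with a , _ , ca ← c-window 0 (y-in i)
    with c-window a (off-in o) | c-window a (off-in o′)
  ... | zero , _ , ct | _ = ⊥-elim (yi≢t (trans (sym ca) (trans (cong c (sym (+-identityʳ a))) ct)))
  ... | _ | zero , _ , ct′ = ⊥-elim (yi≢t′ (trans (sym ca) (trans (cong c (sym (+-identityʳ a))) ct′)))
  ... | suc d , d<L , ct | suc d′ , d′<L , ct′ = ⊥-elim (go (<-cmp d d′))
    where
    Avoid : Fin n → Set
    Avoid u = u ≢ t × u ≢ y i
    good : ∀ {r} → 0 < r → r < L → r ≢ suc d → Avoid (c (a + r))
    good 0<r r<L r≢ = (λ e → r≢ (c-distinct a r<L d<L (trans e (sym ct)))) ,
                      (λ e → c-inj a 0<r r<L (trans ca (sym e)))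
    outside : ∀ {u} → ¬ C u → Avoid u
    outside ¬r = (λ { refl → ¬r (off-in o) }) , (λ { refl → ¬r (y-in i) })
    back : Walk H Avoid t′ w
    back = reverse (walk-map (λ { (inj₁ ¬r) → outside ¬r ; (inj₂ refl) → (t≢t′ ∘ sym) , (yi≢t′ ∘ sym) }) (off-walk o′))
           ++ walk-map outside W
    contra : ∀ {u} → C u → adj H t u ≡ true → Avoid u → Walk H Avoid u t′ → ⊥
    contra {u} u∈ tu av r = card-separates forest i (yi≢t ∘ sym) (proj₂ av) (proj₂ (outside ¬q)) tu
      (flip-adj {X = H} e) (λ { refl → ¬q u∈ }) (r ++ back)
    go : _ → ⊥
    go (tri≈ _ refl _) = t≢t′ (trans (sym ct) ct′)
    go (tri< d<d′ _ _) = contra (c-in (a + suc (suc d)))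
        (subst₂ (λ p q → adj H p q ≡ true) ct (cong c (sym (+-suc a (suc d)))) (c-adj (a + suc d)))
        (good (s≤s z≤n) (≤-<-trans (s≤s d<d′) d′<L) (λ ()))
        (subst (Walk H Avoid _) (trans (cong c shift) ct′)
          (arc (a + suc (suc d)) (d′ ∸ suc d) λ r r≤ → subst (Avoid ∘ c) (sym (+-assoc a _ r))
            (good (s≤s z≤n) (≤-<-trans (s≤s (≤-trans (+-monoʳ-≤ (suc d) r≤) (≤-reflexive (m+[n∸m]≡n d<d′)))) d′<L)
              (λ e → <⇒≢ (s≤s (s≤s (m≤m+n d r))) (sym e)))))
      where
      shift : a + suc (suc d) + (d′ ∸ suc d) ≡ a + suc d′
      shift = trans (+-assoc a _ _) (cong (λ r → a + suc r) (m+[n∸m]≡n d<d′))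
    go (tri> _ _ (s≤s {n = d₀} d′≤d₀)) = contra (c-in (a + suc d₀))
        (flip-adj {X = H} (subst₂ (λ p q → adj H p q ≡ true) refl (trans (cong c (sym (+-suc a (suc d₀)))) ct) (c-adj (a + suc d₀))))
        (good (s≤s z≤n) (<-trans ≤-refl d<L) (λ ()))
        (subst (λ u → Walk H Avoid u t′) (cong c shift) (reverse
          (subst (λ u → Walk H Avoid u (c (a + suc d′ + (d₀ ∸ d′)))) ct′
            (arc (a + suc d′) (d₀ ∸ d′) λ r r≤ → subst (Avoid ∘ c) (sym (+-assoc a _ r))
              (good (s≤s z≤n) (<-trans (s≤s (s≤s (below r≤))) d<L) (λ e → <⇒≢ (s≤s (s≤s (below r≤))) e))))))
      where
      shift : a + suc d′ + (d₀ ∸ d′) ≡ a + suc d₀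
      shift = trans (+-assoc a _ _) (cong (λ r → a + suc r) (m+[n∸m]≡n d′≤d₀))
      below : ∀ {r} → r ≤ d₀ ∸ d′ → d′ + r ≤ d₀
      below r≤ = ≤-trans (+-monoʳ-≤ d′ r≤) (≤-reflexive (m+[n∸m]≡n d′≤d₀))

  module Base (root? : ∀ v → Dec (∃ (Off v))) where

    -- Vertices outside the component of C are their own base, which is then
    -- not in C.
    base : Fin n → Fin n
    base v with root? v
    ... | yes (t , _) = t
    ... | no _        = v

    base-off : ∀ {v t} → Off v t → base v ≡ t
    base-off {v} o with root? v
    ... | yes (_ , o′) = off-unique o′ o
    ... | no ¬o        = ⊥-elim (¬o (_ , o))

    base-C : ∀ {v} → C v → base v ≡ v
    base-C p = base-off (stop p)

    rooted-off : ∀ {v} → C (base v) → Off v (base v)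
    rooted-off {v} p with root? v
    ... | yes (_ , o) = o
    ... | no _        = stop p

    -- The edge gives one endpoint a hanging walk through the other, and by `off-unique` both have
    -- the same root. Edges inside C are excluded because a vertex of C is its own base.
    base-edge : ∀ {v w} → adj H v w ≡ true → ¬ (C v × C w) → C (base v) → base w ≡ base v
    base-edge {v} {w} e ¬vw r with C? v | C? w
    ... | yes p | yes q = ⊥-elim (¬vw (p , q))
    ... | yes p | no ¬q = trans (base-off (step ¬q (flip-adj {X = H} e) (stop p))) (sym (base-C p))
    ... | no ¬p | yes q = trans (base-C q) (sym (base-off (step ¬p e (stop q))))
    ... | no ¬p | no ¬q = base-off (step ¬q (flip-adj {X = H} e) (rooted-off r))

    class-walk : ∀ {v} → C (base v) → Walk H (λ u → base u ≡ base v) v (base v)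
    class-walk {v} r = go (rooted-off r)
      where
      go : ∀ {v t} → Off v t → Walk H (λ u → base u ≡ t) v t
      go (stop p)        = done (base-C p)
      go o@(step _ e o′) = step (base-off o) e (go o′)

-- Large components of the cards

module Pieces {n k : ℕ} {G H : Graph n} (forest : IsForest G) (D : Cards k G H) (2<k : 2 < k)
              (half : 3 + n ≤ k + k) (cw : ClosedWalk H)
              (root? : ∀ v → Dec (∃ (Roots.Off forest D 2<k cw v))) where
  open Cards D public
  open ClosedWalk cw public
  open Roots forest D 2<k cw public
  open Base root? public

  W : Fin n → ℕ
  W u = # (λ v → base v Fin.≟ u)

  w : Fin k → ℕ
  w i = W (y i)

  h : ℕ
  h = # (λ v → C? (base v))

  W-pos : ∀ {u} → C u → 1 ≤ W u
  W-pos {u} p = ≤-trans (≤-reflexive (sym (ind-yes (base u Fin.≟ u) (base-C p)))) (term≤sum (λ v → ind (base v Fin.≟ u)) u)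

  -- The `y i` are distinct, so a vertex is counted for at most one i.
  ∑w≤h : sum w ≤ h
  ∑w≤h = ≤-trans (≤-reflexive (#-∑-comm λ i v → base v Fin.≟ y i)) (sum-mono col)
    where
    col : ∀ v → # (λ i → base v Fin.≟ y i) ≤ ind (C? (base v))
    col v with C? (base v)
    ... | yes _ = #-≤1 (λ i → base v Fin.≟ y i) λ p q → y-inj (trans (sym p) q)
    ... | no ¬p = ≤-trans (sum-≤ _ {0} λ i → ≤-reflexive (ind-no (base v Fin.≟ y i) λ e → ¬p (subst C (sym e) (y-in i))))
                    (≤-reflexive (*-zeroʳ k))

  -- B i is the large component of G − x i, read off from H − y i, and P i the
  -- path in it that comes from the cycle.
  β : Fin k → Fin n → Fin n
  β i v = base (to i v)

  B P : Fin k → Fin n → Set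
  B i v = C (β i v) × β i v ≢ y i
  P i v = C (to i v) × v ≢ x i

  B? : ∀ i → Decidable (B i)
  B? i v = C? (β i v) ×-dec ¬? (β i v Fin.≟ y i)

  P? : ∀ i → Decidable (P i)
  P? i v = C? (to i v) ×-dec ¬? (v Fin.≟ x i)

  x∉B : ∀ i → ¬ B i (x i)
  x∉B i (_ , ne) = ne (trans (cong base (π-x i)) (base-C (y-in i)))

  B-≢x : ∀ {i v} → B i v → v ≢ x i
  B-≢x b refl = x∉B _ b

  P⊆B : ∀ {i v} → P i v → B i v
  P⊆B {i} (p , ne) = subst C (sym (base-C p)) p , λ e → to-≢ ne (trans (sym (base-C p)) e)

  to-adj : ∀ {i u v} → u ≢ x i → v ≢ x i → adj G u v ≡ true → adj H (to i u) (to i v) ≡ true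
  to-adj {i} u≢ v≢ e = trans (π-adj i u≢ v≢) e

  -- In H - `y i` such an edge either keeps the base, by `base-edge`, or joins two vertices of C
  -- other than `y i`.
  B-closed : ∀ {i u v} → v ≢ x i → adj G u v ≡ true → B i u → B i v
  B-closed {i} {u} {v} v≢ e b@(r , ne) with C? (to i u) | C? (to i v)
  ... | yes _ | yes q = P⊆B (q , v≢)
  ... | yes _ | no ¬q = let eq = base-edge (to-adj (B-≢x b) v≢ e) (¬q ∘ proj₂) r in subst C (sym eq) r , ne ∘ trans (sym eq)
  ... | no ¬p | _     = let eq = base-edge (to-adj (B-≢x b) v≢ e) (¬p ∘ proj₁) r in subst C (sym eq) r , ne ∘ trans (sym eq)

  B-back : ∀ {i u v} → u ≢ x i → adj G u v ≡ true → B i v → B i u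
  B-back u≢ e = B-closed u≢ (flip-adj {X = G} e)

  -- The offset from c a along the cycle; 0 outside C.
  pos : ℕ → Fin n → ℕ
  pos a v with C? v
  ... | yes p = proj₁ (c-window a p)
  ... | no _  = 0

  pos<L : ∀ a {v} → C v → pos a v < L
  pos<L a {v} p with C? v
  ... | yes q = proj₁ (proj₂ (c-window a q))
  ... | no ¬q = ⊥-elim (¬q p)

  c-pos : ∀ a {v} → C v → c (a + pos a v) ≡ v
  c-pos a {v} p with C? v
  ... | yes q = proj₂ (proj₂ (c-window a q))
  ... | no ¬q = ⊥-elim (¬q p)

  pos-c : ∀ a {d} → d < L → pos a (c (a + d)) ≡ d
  pos-c a d<L = c-distinct a (pos<L a (c-in _)) d<L (c-pos a (c-in _))

  pos-≢ : ∀ {a u v} → c a ≡ u → C v → v ≢ u → 0 < pos a v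
  pos-≢ {a} {u} {v} ca p ne = n≢0⇒n>0 λ e → ne (trans (sym (c-pos a p)) (trans (cong c (trans (cong (a +_) e) (+-identityʳ a))) ca))

  Between : ℕ → ℕ → ℕ → Fin n → Set
  Between a d e v = ∃ λ r → d ≤ r × r ≤ e × v ≡ c (a + r)

  between : ∀ a {d e} → d ≤ e → Walk H (Between a d e) (c (a + d)) (c (a + e))
  between a {d} {e} d≤e = subst (λ t → Walk H (Between a d e) (c (a + d)) (c t)) (trans (+-assoc a d _) (cong (a +_) (m+[n∸m]≡n d≤e)))
    (arc (a + d) (e ∸ d) λ r r≤ → d + r , m≤m+n d r , ≤-trans (+-monoʳ-≤ d r≤) (≤-reflexive (m+[n∸m]≡n d≤e)) , cong c (+-assoc a d r))

  between-≢ : ∀ {a u d e} → c a ≡ u → 0 < d → e < L → ∀ {v} → Between a d e v → v ≢ u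
  between-≢ {a} ca 0<d e<L (r , d≤r , r≤e , refl) e = c-inj a (<-≤-trans 0<d d≤r) (≤-<-trans r≤e e<L) (trans ca (sym e))

  between-C : ∀ {a d e v} → Between a d e v → C v
  between-C {a} (r , _ , _ , refl) = c-in (a + r)

  -- C is cut open at `y i`: all other vertices get positive offsets, and the arc between two of
  -- them does not wrap around.
  C-walk : ∀ i {u v} → C u → C v → u ≢ y i → v ≢ y i → Walk H (λ t → C t × t ≢ y i) u v
  C-walk i {u} {v} p q u≢ v≢ with a , _ , ca ← c-window 0 (y-in i) with ≤-total (pos a u) (pos a v)
  ... | inj₁ le = subst₂ (Walk H _) (c-pos a p) (c-pos a q)
        (walk-map (λ b → between-C b , between-≢ ca (pos-≢ ca p u≢) (pos<L a q) b) (between a le))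
  ... | inj₂ le = reverse (subst₂ (Walk H _) (c-pos a q) (c-pos a p)
        (walk-map (λ b → between-C b , between-≢ ca (pos-≢ ca q v≢) (pos<L a p) b) (between a le)))

  pulled : ∀ i {Q R : Fin n → Set} → (∀ {v} → Q v → v ≢ y i) → (∀ {v} → Q (to i v) → R v) →
           ∀ {u v} → Walk H Q (to i u) (to i v) → Walk G R u v
  pulled i ne f r = walk-map f (subst₂ (Walk G _) (from-to i _) (from-to i _) (pull i ne r))

  P-walk : ∀ {i u v} → P i u → P i v → Walk G (P i) u v
  P-walk {i} (p , u≢) (q , v≢) = pulled i proj₂ (λ (r , ne) → r , λ { refl → ne (π-x i) }) (C-walk i p q (to-≢ u≢) (to-≢ v≢))

  class-walk-to : ∀ {i v} → B i v → Walk G (λ t → β i t ≡ β i v) v (from i (β i v))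
  class-walk-to {i} {v} (r , ne) = pulled i
    (λ {t} e t≡y → ne (trans (sym e) (trans (cong base t≡y) (base-C (y-in i))))) id
    (subst (Walk H _ _) (sym (to-from i _)) (class-walk r))

  -- Descend from `u` to its base, follow the path `P i`, and climb to `v`.
  B-walk : ∀ {i u v} → B i u → B i v → Walk G (B i) u v
  B-walk {i} {u} {v} p@(r , u≢) q@(s , v≢) =
    walk-map (same p) (class-walk-to p) ++ walk-map P⊆B (P-walk (mid r u≢) (mid s v≢)) ++ reverse (walk-map (same q) (class-walk-to q))
    where
    same : ∀ {u} → B i u → ∀ {t} → β i t ≡ β i u → B i t
    same (r , ne) e = subst C (sym e) r , ne ∘ trans (sym e)
    mid : ∀ {t} → C t → t ≢ y i → P i (from i t)
    mid {t} r ne = subst C (sym (to-from i t)) r , from-≢ ne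

  -- `π i` permutes all the vertices, so sizes in the card of G can be computed in H.
  #β : ∀ i {Q : Fin n → Set} (Q? : Decidable Q) → # (λ v → Q? (β i v)) ≡ # (λ v → Q? (base v))
  #β i Q? = sym (#-permute (λ v → Q? (base v)) (π i))

  B-size : ∀ i → # (B? i) + w i ≡ h
  B-size i = trans (cong (_+ w i) (#β i (λ u → C? u ×-dec ¬? (u Fin.≟ y i)))) (≤-antisym
    (#-disjoint (λ v → C? (base v) ×-dec ¬? (base v Fin.≟ y i)) (λ v → base v Fin.≟ y i) (λ v → C? (base v))
      proj₁ (λ e → subst C (sym e) (y-in i)) (λ (_ , ne) e → ne e))
    (#-cover (λ v → C? (base v) ×-dec ¬? (base v Fin.≟ y i)) (λ v → base v Fin.≟ y i) (λ v → C? (base v)) (λ {v} → split v)))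
    where
    split : ∀ v → C (base v) → (C (base v) × base v ≢ y i) ⊎ base v ≡ y i
    split v r with base v Fin.≟ y i
    ... | yes e = inj₂ e
    ... | no ne = inj₁ (r , ne)

  #C≥L : L ≤ # C?
  #C≥L = ≤-trans (#-all {P = λ _ → ⊤} all _) (#-injective all C? (c ∘ toℕ) (λ _ → c-in _)
           λ {i} {j} _ _ e → Fin.toℕ-injective (c-distinct 0 (Fin.toℕ<n i) (Fin.toℕ<n j) e))
    where
    all : Decidable {A = Fin L} (λ _ → ⊤)
    all _ = yes tt

  #C≤L : # C? ≤ L
  #C≤L = ≤-trans (#-fibres C? all (λ v t → c (toℕ t) Fin.≟ v)
      (λ {v} p → fromℕ< (pos<L 0 p) , tt , trans (cong c (Fin.toℕ-fromℕ< (pos<L 0 p))) (c-pos 0 p))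
      (λ {t} _ → #-≤1 (λ v → C? v ×-dec (c (toℕ t) Fin.≟ v)) λ (_ , e) (_ , e′) → trans (sym e) e′))
    (≤-trans (*-monoˡ-≤ 1 (#-≤ all)) (≤-reflexive (*-identityʳ L)))
    where
    all : Decidable {A = Fin L} (λ _ → ⊤)
    all _ = yes tt

  k≤L : k ≤ L
  k≤L = ≤-trans (≤-trans (#-all {P = λ _ → ⊤} all _) (#-injective all C? y (λ {i} _ → y-in i) λ _ _ → y-inj)) #C≤L
    where
    all : Decidable {A = Fin k} (λ _ → ⊤)
    all _ = yes tt

  P-size : ∀ i → L ≤ 1 + # (P? i)
  P-size i = begin
    L                                   ≤⟨ #C≥L ⟩
    # C?                                ≡⟨ #-permute C? (π i) ⟩
    # (λ v → C? (to i v))               ≤⟨ #-remove (λ v → C? (to i v)) (x i) ⟩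
    1 + # (P? i)                        ∎
    where open ≤-Reasoning

  -- Each path has at least L - 1 ≥ k - 1 vertices, and 2(k - 1) > n by `half`. Therefore any two of
  -- the paths meet.
  n<P+P : ∀ i j → n < # (P? i) + # (P? j)
  n<P+P i j = +-cancelˡ-≤ 2 _ _ (begin
    3 + n                            ≤⟨ half ⟩
    k + k                            ≤⟨ +-mono-≤ (≤-trans k≤L (P-size i)) (≤-trans k≤L (P-size j)) ⟩
    (1 + # (P? i)) + (1 + # (P? j))  ≡⟨ +-suc (1 + # (P? i)) (# (P? j)) ⟩
    2 + (# (P? i) + # (P? j))        ∎)
    where open ≤-Reasoning

  P-meet : ∀ i j → ∃ λ v → P i v × P j v
  P-meet i j = #-meet (P? i) (P? j) (n<P+P i j)

  -- Only the existence of a common vertex matters below, so its computation is kept from unfolding.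
  abstract
    B-meet : ∀ i j → ∃ λ v → B i v × B j v
    B-meet i j = let (v , p , q) = P-meet i j in v , P⊆B p , P⊆B q

  i₀ : Fin k
  i₀ = fromℕ< (≤-trans (s≤s z≤n) 2<k)

  abstract
    b₀ : Fin n
    b₀ = proj₁ (B-meet i₀ i₀)

    b₀∈B : B i₀ b₀
    b₀∈B = proj₁ (proj₂ (B-meet i₀ i₀))

  G₀ : Fin n → Set
  G₀ v = Walk G (λ _ → ⊤) v b₀

  G₀-closed : ∀ {u v} → adj G u v ≡ true → G₀ u → G₀ v
  G₀-closed e r = step tt (flip-adj {X = G} e) r

  -- Every `B i` is connected and meets `B i₀`.
  B⊆G₀ : ∀ {i v} → B i v → G₀ v
  B⊆G₀ {i} b = let (u , p , q) = B-meet i i₀ in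
    walk-map (λ _ → tt) (B-walk b p) ++ walk-map (λ _ → tt) (B-walk q b₀∈B)

  G₀-walk : ∀ {u v} → G₀ u → G₀ v → Walk G G₀ u v
  G₀-walk p q = walk-map proj₂ (walk-closed (λ _ _ → G₀-closed) (p ++ reverse q) p)

  -- Within `G₀` only `x i` could stop `B i` from spreading along the edges.
  outside-B : ∀ {i} → ¬ G₀ (x i) → ∀ {v} → G₀ v → B i v
  outside-B {i} ¬x {v} g = let (u , b , _) = B-meet i i in
    proj₂ (walk-last (walk-closed (λ _ q e → B-closed (λ { refl → ¬x q }) e) (G₀-walk (B⊆G₀ b) g) b))

  -- The component of G that contains all the large pieces

  module Component (G₀? : Decidable G₀) where

    g : ℕ
    g = # G₀?

    X : Fin k → Fin n → Set
    X i v = G₀ v × ¬ B i v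

    X? : ∀ i → Decidable (X i)
    X? i v = G₀? v ×-dec ¬? (B? i v)

    B≤g : ∀ i → # (B? i) ≤ g
    B≤g i = #-mono (B? i) G₀? B⊆G₀

    -- `B i` has h - `w i` vertices and lies in `G₀`. The indicator is gained because `B i` misses
    -- `x i`.
    h≤g+w : ∀ i → h + ind (G₀? (x i)) ≤ g + w i
    h≤g+w i = ≤-trans (≤-reflexive (trans (cong (_+ ind (G₀? (x i))) (trans (sym (B-size i)) (+-comm _ (w i))))
                (+-assoc (w i) _ _))) (≤-trans (+-monoʳ-≤ (w i) (bound (G₀? (x i)))) (≤-reflexive (+-comm (w i) g)))
      where
      bound : (d : Dec (G₀ (x i))) → # (B? i) + ind d ≤ g
      bound (yes p) = ≤-trans (≤-reflexive (+-comm _ 1)) (#-< (B? i) G₀? B⊆G₀ (x i) (x∉B i) p)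
      bound (no _)  = ≤-trans (≤-reflexive (+-identityʳ _)) (B≤g i)

    -- The inequalities `h≤g+w` are summed over i. The w add up to at most h, and at most n - g of
    -- the `x i` lie outside `G₀`.
    h≤g : h ≤ g
    h≤g = ≮⇒≥ λ g<h → absurd (h ∸ suc g) (trans (sym (m+[n∸m]≡n g<h)) (cong suc refl))
      where
      open ≤-Reasoning
      q : ℕ
      q = # (λ i → G₀? (x i))
      total : k * h + q ≤ k * g + h
      total = begin
        k * h + q                             ≡⟨ cong (_+ q) (sym (sum-const k h)) ⟩
        sum {k} (λ _ → h) + q                 ≡⟨ sym (∑-distrib-+ {k} (λ _ → h) (λ i → ind (G₀? (x i)))) ⟩
        sum (λ i → h + ind (G₀? (x i)))       ≤⟨ sum-mono h≤g+w ⟩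
        sum (λ i → g + w i)                   ≡⟨ ∑-distrib-+ {k} (λ _ → g) w ⟩
        sum {k} (λ _ → g) + sum w             ≤⟨ +-mono-≤ (≤-reflexive (sum-const k g)) ∑w≤h ⟩
        k * g + h                             ∎
      few : k + g ≤ q + n
      few = begin
        k + g                                             ≤⟨ +-monoˡ-≤ g (#-dichotomy (λ i → G₀? (x i))) ⟩
        q + # (λ i → ¬? (G₀? (x i))) + g
          ≤⟨ +-monoˡ-≤ g (+-monoʳ-≤ q (#-injective (λ i → ¬? (G₀? (x i))) (λ v → ¬? (G₀? v)) x id λ _ _ → x-inj)) ⟩
        q + # (λ v → ¬? (G₀? v)) + g                      ≡⟨ +-assoc q _ g ⟩
        q + (# (λ v → ¬? (G₀? v)) + g)
          ≤⟨ +-monoʳ-≤ q (≤-trans (#-disjoint (λ v → ¬? (G₀? v)) G₀? all _ _ λ ¬p p → ¬p p) (#-≤ all)) ⟩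
        q + n                                             ∎
        where
        all : Decidable {A = Fin n} (λ _ → ⊤)
        all _ = yes tt
      eqˡ : ∀ k g a q → k * suc (g + a) + q + (k + g) ≡ (k * g + g + q) + (k + k + k * a)
      eqˡ = solve-∀
      eqʳ : ∀ k g a q n → k * g + suc (g + a) + (q + n) ≡ (k * g + g + q) + (1 + n + a)
      eqʳ = solve-∀
      -- With h = g + 1 + a, `total` and `few` add up to 2k + ka ≤ 1 + n + a, whereas 2k ≥ n + 3 and
      -- ka ≥ a.
      absurd : ∀ a → h ≡ suc (g + a) → ⊥
      absurd a e = <⇒≱ (<-≤-trans (n<1+n _) (≤-trans (n≤1+n _) (+-mono-≤ half (m≤n*m a k {{>-nonZero (≤-trans (s≤s z≤n) 2<k)}}))))
        (+-cancelˡ-≤ (k * g + g + q) _ _ (subst₂ _≤_ (eqˡ k g a q) (eqʳ k g a q n)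
          (+-mono-≤ (subst (λ t → k * t + q ≤ k * g + t) e total) few)))

    W≥1 : ∀ i → 1 ≤ w i
    W≥1 i = W-pos (y-in i)

    -- Otherwise `B i` would be all of `G₀`, but it has only h - `w i` < g vertices.
    x∈G₀ : ∀ i → G₀ (x i)
    x∈G₀ i with G₀? (x i)
    ... | yes p = p
    ... | no ¬p = ⊥-elim (<⇒≱ (W≥1 i) (+-cancelˡ-≤ (# (B? i)) _ _ (begin
      # (B? i) + w i   ≡⟨ B-size i ⟩
      h                ≤⟨ h≤g ⟩
      g                ≤⟨ #-mono G₀? (B? i) (outside-B ¬p) ⟩
      # (B? i)         ≡⟨ sym (+-identityʳ _) ⟩
      # (B? i) + 0     ∎)))
      where open ≤-Reasoning

    X-size : ∀ i → # (X? i) + # (B? i) ≡ g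
    X-size i = ≤-antisym (#-disjoint (X? i) (B? i) G₀? proj₁ B⊆G₀ λ (_ , ¬b) b → ¬b b)
      (#-cover (X? i) (B? i) G₀? (λ {v} p → split p (B? i v)))
      where
      split : ∀ {v} → G₀ v → Dec (B i v) → X i v ⊎ B i v
      split p (yes b) = inj₂ b
      split p (no ¬b) = inj₁ (p , ¬b)

    X+h : ∀ i → # (X? i) + h ≡ g + w i
    X+h i = trans (cong (# (X? i) +_) (sym (B-size i))) (trans (sym (+-assoc (# (X? i)) _ _)) (cong (_+ w i) (X-size i)))

    -- By `B-back` a walk can enter `B i` only from `x i`. Before that it stays in `X i`, and the
    -- entering edge supplies a neighbour of `x i` in `B i`.
    exit : ∀ {i v b} → Walk G G₀ v b → ¬ B i v → B i b → Walk G (X i) v (x i) × ∃ λ u → B i u × adj G (x i) u ≡ true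
    exit (done p) ¬b b = ⊥-elim (¬b b)
    exit {i} {v} (step {w = u} p e r) ¬b b with B? i u
    ... | no ¬bu = let (W , z) = exit r ¬bu b in step (p , ¬b) e W , z
    ... | yes bu with v Fin.≟ x i
    ...   | yes refl = done (p , ¬b) , u , bu , e
    ...   | no ne = ⊥-elim (¬b (B-back ne e bu))

    X-walk : ∀ {i v} → X i v → Walk G (X i) v (x i)
    X-walk {i} (p , ¬b) = let (u , b , _) = B-meet i i in proj₁ (exit (G₀-walk p (B⊆G₀ b)) ¬b b)

    X-adj : ∀ i → ∃ λ u → B i u × adj G (x i) u ≡ true
    X-adj i = let (u , b , _) = B-meet i i in proj₂ (exit (G₀-walk (x∈G₀ i) (B⊆G₀ b)) (x∉B i) b)

    -- `B i` is connected, meets `B j` and misses `x j`, so it cannot leave `B j`.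
    B⊆B : ∀ {i j} → ¬ B i (x j) → ∀ {v} → B i v → B j v
    B⊆B {i} {j} ¬b {v} bv = let (u , p , q) = B-meet i j in
      proj₂ (walk-last (walk-closed (λ _ r e → B-closed (λ { refl → ¬b r }) e) (B-walk p bv) q))

    x∈B : ∀ {i j} → i ≢ j → ¬ B i (x j) → B j (x i)
    x∈B {i} {j} i≢j ¬b = let (u , b , e) = X-adj i in B-back (i≢j ∘ x-inj) e (B⊆B ¬b b)

    -- `B i` is contained in `B j`, properly because of `x i`, and by `B-size` a larger B means a
    -- smaller w.
    w-< : ∀ {i j} → i ≢ j → ¬ B i (x j) → w j < w i
    w-< {i} {j} i≢j ¬b = +-cancelˡ-< (# (B? i)) _ _ (begin-strict
      # (B? i) + w j  <⟨ +-monoˡ-< (w j) (#-< (B? i) (B? j) (B⊆B ¬b) (x i) (x∉B i) (x∈B i≢j ¬b)) ⟩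
      # (B? j) + w j  ≡⟨ trans (B-size j) (sym (B-size i)) ⟩
      # (B? i) + w i  ∎)
      where open ≤-Reasoning

    -- An edge can leave `B i` only to `x i`, which lies in `B j`, and conversely; so the union is
    -- closed under adjacency and fills `G₀`. The pieces `X i` and `X j` are then disjoint.
    B∪B : ∀ {i j} → B i (x j) → B j (x i) → ∀ {v} → G₀ v → B i v ⊎ B j v
    B∪B {i} {j} bi bj p = let (u , b , _) = B-meet i i in
      proj₂ (walk-last (walk-closed (λ _ _ e → closed e) (G₀-walk (B⊆G₀ b) p) (inj₁ b)))
      where
      closed : ∀ {u v} → adj G u v ≡ true → B i u ⊎ B j u → B i v ⊎ B j v
      closed {v = v} e s with v Fin.≟ x i | v Fin.≟ x j
      ... | yes refl | _ = inj₂ bj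
      ... | _ | yes refl = inj₁ bi
      closed e (inj₁ b) | no p | no _ = inj₁ (B-closed p e b)
      closed e (inj₂ b) | no _ | no q = inj₂ (B-closed q e b)

    Equal : ℕ → Fin k → Fin k → Set
    Equal ω i j = P i (x j) × w j ≡ ω

    Equal? : ∀ ω i → Decidable (Equal ω i)
    Equal? ω i j = P? i (x j) ×-dec (w j ≟ ω)

    -- The middle one of three vertices x j with equal w on the path P i would
    -- separate the outer two, although both lie in its B.
    three-on-path : ∀ {ω i j j′ j″} → Equal ω i j → Equal ω i j′ → Equal ω i j″ →
                    j ≢ j′ → j′ ≢ j″ → j ≢ j″ → ⊥
    three-on-path {ω} {i} = sort₃ {P = Equal ω i} key key-inj chain
      where
      a : ℕ
      a = proj₁ (c-window 0 (y-in i))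
      ca : c a ≡ y i
      ca = proj₂ (proj₂ (c-window 0 (y-in i)))
      key : Fin k → ℕ
      key j = pos a (to i (x j))
      at : ∀ {j} → Equal ω i j → c (a + key j) ≡ to i (x j)
      at ((p , _) , _) = c-pos a p
      key<L : ∀ {j} → Equal ω i j → key j < L
      key<L ((p , _) , _) = pos<L a p
      0<key : ∀ {j} → Equal ω i j → 0 < key j
      0<key ((p , ne) , _) = pos-≢ ca p (to-≢ ne)
      key-inj : ∀ {j j′} → Equal ω i j → Equal ω i j′ → key j ≡ key j′ → j ≡ j′
      key-inj {j} {j′} p q e = x-inj (trans (sym (from-to i (x j))) (trans (cong (from i)
        (trans (sym (at p)) (trans (cong (λ t → c (a + t)) e) (at q)))) (from-to i (x j′))))
      in-B : ∀ {j j′} → Equal ω i j → Equal ω i j′ → j ≢ j′ → B j′ (x j)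
      in-B {j} {j′} (_ , e) (_ , e′) ne with B? j′ (x j)
      ... | yes b = b
      ... | no ¬b = ⊥-elim (<⇒≢ (w-< (ne ∘ sym) ¬b) (trans e (sym e′)))
      chain : ∀ {j j′ j″} → Equal ω i j → Equal ω i j′ → Equal ω i j″ → key j < key j′ → key j′ < key j″ → ⊥
      chain {j} {j′} {j″} p q r lt lt′ with key j′ in eq
      -- The middle vertex has offset `suc d`, so its cycle neighbours have offsets d and d + 2. The
      -- forbidden walk follows the path from these to the outer vertices, which are joined to each
      -- other inside `B j′`.
      chain {j} {j′} {j″} p q r (s≤s {n = d} le) lt′ | suc d = forest-separates forest
        (adj′ pred-≢ (flip-adj {X = H} (subst (λ t → adj H (c (a + d)) t ≡ true)
          (trans (cong c (sym (+-suc a d))) at′) (c-adj (a + d)))))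
        (adj′ succ-≢ (subst₂ (λ s t → adj H s t ≡ true) at′ (cong c (sym (+-suc a (suc d)))) (c-adj (a + suc d))))
        (λ e → <⇒≢ (s≤s (n≤1+n d)) (c-distinct a (<-trans (n<1+n d) (<-trans lt′ (key<L r)))
          (≤-<-trans lt′ (key<L r)) (from-injective i e)))
        (reverse left ++ walk-map B-≢x (B-walk (in-B p q j≢j′) (in-B r q (j≢j″ ∘ sym))) ++ reverse right)
        where
        at′ : c (a + suc d) ≡ to i (x j′)
        at′ = trans (cong (λ t → c (a + t)) (sym eq)) (at q)
        j≢j′ : j ≢ j′
        j≢j′ refl = <⇒≢ (s≤s le) eq
        j≢j″ : j′ ≢ j″
        j≢j″ refl = <⇒≢ lt′ (sym eq)
        pred-≢ : c (a + d) ≢ y i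
        pred-≢ e = c-inj a (<-≤-trans (0<key p) le) (<-trans (n<1+n d) (<-trans lt′ (key<L r))) (trans ca (sym e))
        succ-≢ : c (a + suc (suc d)) ≢ y i
        succ-≢ e = c-inj a (s≤s z≤n) (≤-<-trans lt′ (key<L r)) (trans ca (sym e))
        adj′ : ∀ {v} → v ≢ y i → adj H (to i (x j′)) v ≡ true → adj G (x j′) (from i v) ≡ true
        adj′ ne e = subst (λ t → adj G t _ ≡ true) (from-to i (x j′)) (from-adj i (to-≢ (proj₂ (proj₁ q))) ne e)
        part : ∀ {d₁ d₂ u v} → c (a + d₁) ≡ u → c (a + d₂) ≡ v → d₁ ≤ d₂ → 0 < d₁ → d₂ < L →
               (∀ {r} → d₁ ≤ r → r ≤ d₂ → r ≢ suc d) → Walk G (_≢ x j′) (from i u) (from i v)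
        part refl refl le 0<d₁ d₂<L ne = walk-map
          (λ { {v} (s , d₁≤ , ≤d₂ , e) refl → ne d₁≤ ≤d₂ (c-distinct a (≤-<-trans ≤d₂ d₂<L) (<-trans lt′ (key<L r)) (trans (sym e) (sym at′))) })
          (pull i (between-≢ ca 0<d₁ d₂<L) (between a le))
        left : Walk G (_≢ x j′) (x j) (from i (c (a + d)))
        left = subst (λ t → Walk G (_≢ x j′) t (from i (c (a + d)))) (from-to i (x j))
                 (part (at p) refl le (0<key p) (<-trans (n<1+n d) (<-trans lt′ (key<L r)))
                 λ _ r≤d → <⇒≢ (s≤s r≤d))
        right : Walk G (_≢ x j′) (from i (c (a + suc (suc d)))) (x j″)
        right = subst (Walk G (_≢ x j′) (from i (c (a + suc (suc d))))) (from-to i (x j″))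
                  (part refl (at r) lt′ (s≤s z≤n) (key<L r) λ d<r _ e → <⇒≢ d<r (sym e))

    #Equal≤2 : ∀ ω i → # (Equal? ω i) ≤ 2
    #Equal≤2 ω i = #-≤2 (Equal? ω i) three-on-path

    w≤n : sum w ≤ n
    w≤n = ≤-trans ∑w≤h (#-≤ (λ v → C? (base v)))

    on : Fin k → ℕ
    on i = # (λ j → P? i (x j))

    -- `P i` is connected, meets `P j` and misses `x j`.
    off-path : ∀ {i j u} → ¬ P i (x j) → P i u → B j u
    off-path {i} {j} ¬p p = let (v , q , r) = P-meet i j in
      proj₂ (walk-last (walk-closed (λ _ s e → B-closed (λ { refl → ¬p s }) e) (P-walk q p) (P⊆B r)))

    -- The `x j` off `P i` are distinct, and there is room for at most n - L + 1 of them.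
    k+L≤on : ∀ i → k + L ≤ 1 + n + on i
    k+L≤on i = begin
      k + L
        ≤⟨ +-mono-≤ (#-dichotomy (λ j → P? i (x j))) (P-size i) ⟩
      on i + # (λ j → ¬? (P? i (x j))) + (1 + # (P? i))
        ≤⟨ +-monoˡ-≤ _ (+-monoʳ-≤ (on i) (#-injective (λ j → ¬? (P? i (x j))) (λ v → ¬? (P? i v)) x id λ _ _ → x-inj)) ⟩
      on i + # (λ v → ¬? (P? i v)) + (1 + # (P? i))
        ≡⟨ shuffle (on i) (# (λ v → ¬? (P? i v))) (# (P? i)) ⟩
      1 + (# (λ v → ¬? (P? i v)) + # (P? i)) + on i
        ≤⟨ +-monoˡ-≤ (on i) (s≤s (≤-trans (#-disjoint (λ v → ¬? (P? i v)) (P? i) all _ _ λ ¬p p → ¬p p) (#-≤ all))) ⟩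
      1 + n + on i                                                 ∎
      where
      open ≤-Reasoning
      all : Decidable {A = Fin n} (λ _ → ⊤)
      all _ = yes tt
      shuffle : ∀ a b c → a + b + (1 + c) ≡ 1 + (b + c) + a
      shuffle = solve-∀

    -- Each of the values 1, ..., M of w occurs at most twice on the path.
    #on≤ : ∀ i M → # (λ j → P? i (x j) ×-dec (w j ≤? M)) ≤ M * 2
    #on≤ i M = ≤-trans (#-fibres (λ j → P? i (x j) ×-dec (w j ≤? M)) all (λ j t → w j ≟ suc (toℕ t))
        (λ {j} (_ , le) → value (w j) (W≥1 j) le)
        (λ {t} _ → ≤-trans (#-mono (λ j → (P? i (x j) ×-dec (w j ≤? M)) ×-dec (w j ≟ suc (toℕ t))) (Equal? (suc (toℕ t)) i)
          λ ((p , _) , e) → p , e) (#Equal≤2 (suc (toℕ t)) i)))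
      (*-monoˡ-≤ 2 (#-≤ all))
      where
      all : Decidable {A = Fin M} (λ _ → ⊤)
      all _ = yes tt
      value : ∀ ω → 1 ≤ ω → ω ≤ M → ∃ λ (t : Fin M) → ⊤ × ω ≡ suc (toℕ t)
      value (suc ω) _ le = fromℕ< le , tt , cong suc (sym (Fin.toℕ-fromℕ< le))

    X⊆X : ∀ {i j v} → ¬ B i (x j) → X j v → X i v
    X⊆X ¬b (p , ¬bj) = p , λ b → ¬bj (B⊆B ¬b b)

    -- The pieces form a laminar family, and by `w-<` nested pieces of different indices have
    -- different w.
    X-disjoint : ∀ {ω i j v} → w i ≡ ω → w j ≡ ω → X i v → X j v → i ≡ j
    X-disjoint {i = i} {j} e e′ (p , ¬bi) (_ , ¬bj) with i Fin.≟ j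
    ... | yes eq = eq
    ... | no i≢j with B? i (x j) | B? j (x i)
    ...   | no ¬b | _ = ⊥-elim (<⇒≢ (w-< i≢j ¬b) (trans e′ (sym e)))
    ...   | yes _ | no ¬b = ⊥-elim (<⇒≢ (w-< (i≢j ∘ sym) ¬b) (trans e (sym e′)))
    ...   | yes b | yes b′ with B∪B b b′ p
    ...     | inj₁ c = ⊥-elim (¬bi c)
    ...     | inj₂ c = ⊥-elim (¬bj c)

    Unused : Fin n → Set
    Unused v = ¬ ∃ λ j → x j ≡ v

    used? : ∀ v → Dec (∃ λ j → x j ≡ v)
    used? v = Fin.any? λ j → x j Fin.≟ v

    -- The case g > h

    module Larger (h<g : h < g) (222<k : 222 < k) where

      #X≥2 : ∀ i → 2 ≤ # (X? i)
      #X≥2 i = +-cancelʳ-≤ h _ _ (begin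
        2 + h         ≤⟨ +-mono-≤ (W≥1 i) h<g ⟩
        w i + g       ≡⟨ +-comm (w i) g ⟩
        g + w i       ≡⟨ sym (X+h i) ⟩
        # (X? i) + h  ∎)
        where open ≤-Reasoning

      -- Descent on w: the piece has a vertex besides `x j`, and if that is some `x m`, then `X m`
      -- lies inside `X j` and has smaller w.
      unused : ∀ j → ∃ λ v → X j v × Unused v
      unused j = go (w j) j ≤-refl
        where
        go : ∀ b j → w j ≤ b → ∃ λ v → X j v × Unused v
        go zero    j le = ⊥-elim (<⇒≱ (W≥1 j) le)
        go (suc b) j le with #-witness (λ v → X? j v ×-dec ¬? (v Fin.≟ x j)) (+-cancelˡ-≤ 1 _ _ (≤-trans (#X≥2 j) (#-remove (X? j) (x j))))
        ... | v , xv , v≢ with used? v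
        ...   | no ¬u = v , xv , ¬u
        ...   | yes (m , refl) =
          let (u , xu , ¬u) = go b m (≤-pred (<-≤-trans (w-< (λ { refl → v≢ refl }) (proj₂ xv)) le)) in
          u , X⊆X (proj₂ xv) xu , ¬u

      #w : ℕ → ℕ
      #w ω = # (λ j → w j ≟ ω)

      #w≤on : ∀ ω i → #w ω ≤ on i
      #w≤on ω i = +-cancelˡ-≤ (3 + n) _ _ (begin
        3 + n + #w ω                                       ≤⟨ +-monoˡ-≤ _ (≤-trans half (+-monoʳ-≤ k k≤L)) ⟩
        k + L + #w ω
          ≤⟨ +-mono-≤ (+-mono-≤ (#-dichotomy (λ j → P? i (x j))) (P-size i)) splitω ⟩
        (on i + off) + (1 + p) + (2 + free)                ≡⟨ shuffle (on i) off p free ⟩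
        3 + (off + free + p) + on i                        ≤⟨ +-monoˡ-≤ (on i) (+-monoʳ-≤ 3 (begin
           off + free + p                                  ≤⟨ +-monoˡ-≤ p (≤-trans (+-monoˡ-≤ free
                (#-injective (λ j → ¬? (P? i (x j))) (λ v → used? v ×-dec ¬? (P? i v)) x (λ {j} ¬p → (j , refl) , ¬p) λ _ _ → x-inj))
                (#-disjoint (λ v → used? v ×-dec ¬? (P? i v)) free? (λ v → ¬? (P? i v)) proj₂ proj₂ λ (u , _) (¬u , _) → ¬u u)) ⟩
           # (λ v → ¬? (P? i v)) + p
             ≤⟨ ≤-trans (#-disjoint (λ v → ¬? (P? i v)) (P? i) all _ _ λ ¬p p → ¬p p) (#-≤ all) ⟩
           n                                               ∎)) ⟩
        3 + n + on i                                       ∎)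
        where
        open ≤-Reasoning
        all : Decidable {A = Fin n} (λ _ → ⊤)
        all _ = yes tt
        free? : Decidable (λ v → Unused v × ¬ P i v)
        free? v = ¬? (used? v) ×-dec ¬? (P? i v)
        off p free : ℕ
        off = # (λ j → ¬? (P? i (x j)))
        p = # (P? i)
        free = # free?
        shuffle : ∀ a b c d → (a + b) + (1 + c) + (2 + d) ≡ 3 + (b + d + c) + a
        shuffle = solve-∀
        out? : Decidable (λ j → w j ≡ ω × ¬ P i (x j))
        out? j = (w j ≟ ω) ×-dec ¬? (P? i (x j))
        split : ∀ {j} → w j ≡ ω → Dec (P i (x j)) → Equal ω i j ⊎ (w j ≡ ω × ¬ P i (x j))
        split e (yes p) = inj₁ (p , e)
        split e (no ¬p) = inj₂ (e , ¬p)
        splitω : #w ω ≤ 2 + free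
        splitω = ≤-trans (#-cover (Equal? ω i) out? (λ j → w j ≟ ω) (λ {j} e → split e (P? i (x j))))
          (+-mono-≤ (#Equal≤2 ω i) (≤-trans (#-fibres out? free? X?
            (λ {j} (_ , ¬p) → let (v , xv , ¬u) = unused j in v , (¬u , λ q → proj₂ xv (off-path ¬p q)) , xv)
            (λ {v} _ → #-≤1 (λ j → out? j ×-dec X? j v) λ ((e , _) , xi) ((e′ , _) , xj) → X-disjoint e e′ xi xj))
            (≤-reflexive (*-identityʳ free))))

      -- Adding 2 to each w equal to 1 and 1 to each equal to 2 makes all of them at least 3, so 3k
      -- ≤ n + 3 `on i₀`. At most 12 of the `x j` on the path have w ≤ 6 and the others weigh at
      -- least 7, so 7 `on i₀` ≤ 84 + n. With n + 3 ≤ 2k this leaves k ≤ 222.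
      impossible : ⊥
      impossible = <⇒≱ 222<k (+-cancelˡ-≤ (20 * k + 30) _ _ (begin
          20 * k + 30 + k                                   ≡⟨ eq₁ k ⟩
          7 * (k * 3) + 30                                  ≤⟨ +-monoˡ-≤ 30 (*-monoʳ-≤ 7 three-k) ⟩
          7 * (n + on i₀ * 3) + 30                          ≡⟨ eq₂ n (on i₀) ⟩
          7 * n + 3 * (7 * on i₀) + 30
            ≤⟨ +-monoˡ-≤ 30 (+-monoʳ-≤ (7 * n) (*-monoʳ-≤ 3 seven-on)) ⟩
          7 * n + 3 * (84 + n) + 30                         ≡⟨ eq₃ n ⟩
          10 * (3 + n) + 252                                ≤⟨ +-monoˡ-≤ 252 (*-monoʳ-≤ 10 half) ⟩
          10 * (k + k) + 252                                ≡⟨ eq₄ k ⟩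
          20 * k + 30 + 222                                 ∎))
        where
        open ≤-Reasoning
        eq₁ : ∀ k → 20 * k + 30 + k ≡ 7 * (k * 3) + 30
        eq₁ = solve-∀
        eq₂ : ∀ n o → 7 * (n + o * 3) + 30 ≡ 7 * n + 3 * (7 * o) + 30
        eq₂ = solve-∀
        eq₃ : ∀ n → 7 * n + 3 * (84 + n) + 30 ≡ 10 * (3 + n) + 252
        eq₃ = solve-∀
        eq₄ : ∀ k → 10 * (k + k) + 252 ≡ 20 * k + 30 + 222
        eq₄ = solve-∀
        three : ∀ ω (d : Dec (ω ≡ 1)) (e : Dec (ω ≡ 2)) → 1 ≤ ω → 3 ≤ ω + (ind d * 2 + ind e)
        three 1 (yes _) e _ = s≤s (s≤s (s≤s z≤n))
        three 1 (no ne) e _ = ⊥-elim (ne refl)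
        three 2 d (yes _) _ = +-monoʳ-≤ 2 (m≤n+m 1 _)
        three 2 d (no ne) _ = ⊥-elim (ne refl)
        three (suc (suc (suc ω))) d e _ = s≤s (s≤s (s≤s z≤n))
        three-k : k * 3 ≤ n + on i₀ * 3
        three-k = begin
          k * 3
            ≤⟨ sum-≥ _ (λ j → three (w j) (w j ≟ 1) (w j ≟ 2) (W≥1 j)) ⟩
          sum (λ j → w j + (ind (w j ≟ 1) * 2 + ind (w j ≟ 2)))
            ≡⟨ ∑-distrib-+ w (λ j → ind (w j ≟ 1) * 2 + ind (w j ≟ 2)) ⟩
          sum w + sum (λ j → ind (w j ≟ 1) * 2 + ind (w j ≟ 2))
            ≡⟨ cong (sum w +_) (∑-distrib-+ (λ j → ind (w j ≟ 1) * 2) (λ j → ind (w j ≟ 2))) ⟩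
          sum w + (sum (λ j → ind (w j ≟ 1) * 2) + #w 2)
            ≡⟨ cong (λ t → sum w + (t + #w 2)) (sum-*ˡ (λ j → ind (w j ≟ 1)) 2) ⟩
          sum w + (#w 1 * 2 + #w 2)
            ≤⟨ +-mono-≤ w≤n (+-mono-≤ (*-monoˡ-≤ 2 (#w≤on 1 i₀)) (#w≤on 2 i₀)) ⟩
          n + (on i₀ * 2 + on i₀)                                                 ≡⟨ eq n (on i₀) ⟩
          n + on i₀ * 3                                                           ∎
          where
          eq : ∀ n o → n + (o * 2 + o) ≡ n + o * 3
          eq = solve-∀
        big? : Decidable (λ j → 6 < w j)
        big? j = 6 <? w j
        seven : ∀ ω (d : Dec (6 < ω)) → ind d * 7 ≤ ω
        seven ω (yes p) = p
        seven ω (no _)  = z≤n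
        split : ∀ j → P i₀ (x j) → Dec (w j ≤ 6) → (P i₀ (x j) × w j ≤ 6) ⊎ 6 < w j
        split j p (yes le) = inj₁ (p , le)
        split j p (no ¬le) = inj₂ (≰⇒> ¬le)
        seven-on : 7 * on i₀ ≤ 84 + n
        seven-on = begin
          7 * on i₀
            ≤⟨ *-monoʳ-≤ 7 (≤-trans (#-cover (λ j → P? i₀ (x j) ×-dec (w j ≤? 6)) big? (λ j → P? i₀ (x j)) (λ {j} p → split j p (w j ≤? 6))) (+-monoˡ-≤ (# big?) (#on≤ i₀ 6))) ⟩
          7 * (12 + # big?)         ≡⟨ eq (# big?) ⟩
          84 + # big? * 7           ≡⟨ cong (84 +_) (sym (sum-*ˡ (λ j → ind (big? j)) 7)) ⟩
          84 + sum (λ j → ind (big? j) * 7)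
            ≤⟨ +-monoʳ-≤ 84 (≤-trans (sum-mono (λ j → seven (w j) (big? j))) w≤n) ⟩
          84 + n                    ∎
          where
          eq : ∀ b → 7 * (12 + b) ≡ 84 + b * 7
          eq = solve-∀

    -- The case g = h: heaviest vertices of the cycle

    module Tight (g≤h : g ≤ h) (M : ℕ) (W≤M : ∀ {u} → C u → W u ≤ M) where

      #X : ∀ i → # (X? i) ≡ w i
      #X i = +-cancelˡ-≡ h _ _ (trans (+-comm h _) (trans (X+h i) (cong (_+ w i) (≤-antisym g≤h h≤g))))

      k+L≤ : k + L ≤ 1 + n + M * 2
      k+L≤ = ≤-trans (k+L≤on i₀) (+-monoʳ-≤ (1 + n) (≤-trans
        (#-mono (λ j → P? i₀ (x j)) (λ j → P? i₀ (x j) ×-dec (w j ≤? M)) (λ {j} p → p , W≤M (y-in j))) (#on≤ i₀ M)))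

      -- Off the path P i the piece X j would hang, with an extra root, on a
      -- single vertex of C.
      heaviest-on-path : ∀ {i j} → w j ≡ M → B j (x i) → P i (x j)
      heaviest-on-path {i} {j} wj b with P? i (x j)
      ... | yes p = p
      ... | no ¬p = ⊥-elim (<⇒≱ (begin-strict
          M                                     ≡⟨ sym (trans (#X j) wj) ⟩
          # (X? j)
            <⟨ #-< (X? j) (λ v → β i v Fin.≟ t) (proj₁ ∘ hung) (from i t) not-hung (trans (cong base (to-from i t)) (base-C t∈C)) ⟩
          # (λ v → β i v Fin.≟ t)               ≡⟨ #β i (Fin._≟ t) ⟩
          W t                                   ∎) (W≤M t∈C))
        where
        open ≤-Reasoning
        i≢j : i ≢ j
        i≢j refl = x∉B i b
        b′ : B i (x j)
        b′ with B? i (x j)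
        ... | yes q = q
        ... | no ¬q = ⊥-elim (<⇒≱ (w-< i≢j ¬q) (≤-trans (W≤M (y-in i)) (≤-reflexive (sym wj))))
        t : Fin n
        t = β i (x j)
        t∈C : C t
        t∈C = proj₁ b′
        Hung : Fin n → Set
        Hung v = β i v ≡ t × ¬ C (to i v)
        X-≢ : ∀ {v} → X j v → v ≢ x i
        X-≢ (_ , ¬b) refl = ¬b b
        hung : ∀ {v} → X j v → Hung v
        hung xv = proj₂ (walk-last (walk-closed closed (reverse (X-walk xv))
            (refl , λ c → ¬p (c , i≢j ∘ sym ∘ x-inj))))
          where
          closed : ∀ {u v} → X j u → X j v → adj G u v ≡ true → Hung u → Hung v
          closed xu xv e (eq , ¬c) =
            trans (base-edge (to-adj (X-≢ xu) (X-≢ xv) e) (¬c ∘ proj₁) (subst C (sym eq) t∈C)) eq ,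
            λ c → proj₂ xv (off-path ¬p (c , X-≢ xv))
        not-hung : ¬ X j (from i t)
        not-hung xv = proj₂ (hung xv) (subst C (sym (to-from i t)) t∈C)

      -- The pieces of three such indices have M vertices each, so some `x i` avoids all three. By
      -- `heaviest-on-path` all three vertices then lie on `P i`, against `three-on-path`.
      #heaviest≤2 : M * 3 < k → # (λ j → w j ≟ M) ≤ 2
      #heaviest≤2 3M<k = #-≤2 (λ j → w j ≟ M) λ {j₁} {j₂} {j₃} e₁ e₂ e₃ ne ne′ ne″ →
        let (i , b₁ , b₂ , b₃) = #-witness (all? j₁ j₂ j₃) (count j₁ j₂ j₃ e₁ e₂ e₃) in
        three-on-path (heaviest-on-path e₁ b₁ , e₁) (heaviest-on-path e₂ b₂ , e₂) (heaviest-on-path e₃ b₃ , e₃) ne ne′ ne″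
        where
        out? : ∀ j → Decidable (λ i → ¬ B j (x i))
        out? j i = ¬? (B? j (x i))
        all? : ∀ j₁ j₂ j₃ → Decidable (λ i → B j₁ (x i) × B j₂ (x i) × B j₃ (x i))
        all? j₁ j₂ j₃ i = B? j₁ (x i) ×-dec (B? j₂ (x i) ×-dec B? j₃ (x i))
        two? : ∀ j₂ j₃ → Decidable (λ i → B j₂ (x i) × B j₃ (x i))
        two? j₂ j₃ i = B? j₂ (x i) ×-dec B? j₃ (x i)
        few : ∀ j → w j ≡ M → # (out? j) ≤ M
        few j e = ≤-trans (#-injective (out? j) (X? j) x (λ {i} ¬b → x∈G₀ i , ¬b) λ _ _ → x-inj) (≤-reflexive (trans (#X j) e))
        cover : ∀ {Q : Fin k → Set} j (Q? : Decidable Q) → # Q? ≤ # (out? j) + # (λ i → B? j (x i) ×-dec Q? i)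
        cover {Q} j Q? = #-cover (out? j) (λ i → B? j (x i) ×-dec Q? i) Q? λ {i} q → split q (B? j (x i))
          where
          split : ∀ {i} → Q i → Dec (B j (x i)) → ¬ B j (x i) ⊎ (B j (x i) × Q i)
          split q (yes b) = inj₂ (b , q)
          split q (no ¬b) = inj₁ ¬b
        count : ∀ j₁ j₂ j₃ → w j₁ ≡ M → w j₂ ≡ M → w j₃ ≡ M → 0 < # (all? j₁ j₂ j₃)
        count j₁ j₂ j₃ e₁ e₂ e₃ = +-cancelˡ-≤ (M * 3) _ _ (begin
          M * 3 + 1                                                      ≡⟨ +-comm (M * 3) 1 ⟩
          1 + M * 3                                                      ≤⟨ 3M<k ⟩
          k                                                              ≤⟨ #-dichotomy (λ i → B? j₃ (x i)) ⟩
          # (λ i → B? j₃ (x i)) + # (out? j₃)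
            ≤⟨ +-mono-≤ (≤-trans (cover j₂ (λ i → B? j₃ (x i)))
                                                                              (+-mono-≤ (few j₂ e₂) (≤-trans (cover j₁ (two? j₂ j₃)) (+-monoˡ-≤ _ (few j₁ e₁))))) (few j₃ e₃) ⟩
          M + (M + # (all? j₁ j₂ j₃)) + M                                ≡⟨ shuffle M _ ⟩
          M * 3 + # (all? j₁ j₂ j₃)                                      ∎)
          where
          open ≤-Reasoning
          shuffle : ∀ m a → m + (m + a) + m ≡ m * 3 + a
          shuffle = solve-∀

      -- Only L - k vertices of C are no `y j`, and among the `y j` at most two are heaviest.
      #heaviest+k≤ : M * 3 < k → # (λ t → C? t ×-dec (W t ≟ M)) + k ≤ 2 + L
      #heaviest+k≤ 3M<k = begin
        # (λ t → C? t ×-dec (W t ≟ M)) + k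
          ≤⟨ +-mono-≤ (#-cover hit? unhit? (λ t → C? t ×-dec (W t ≟ M)) (λ {t} p → split p (hit t))) k≤ ⟩
        # hit? + # unhit? + # inY?                            ≡⟨ +-assoc (# hit?) _ _ ⟩
        # hit? + (# unhit? + # inY?)
          ≤⟨ +-mono-≤ hit≤2 (≤-trans (#-disjoint unhit? inY? C? proj₁ (λ { (j , refl) → y-in j }) (λ (_ , ¬p) p → ¬p p)) #C≤L) ⟩
        2 + L                                                 ∎
        where
        open ≤-Reasoning
        hit : ∀ t → Dec (∃ λ j → y j ≡ t)
        hit t = Fin.any? λ j → y j Fin.≟ t
        inY? : Decidable (λ t → ∃ λ j → y j ≡ t)
        inY? = hit
        hit? : Decidable (λ t → (∃ λ j → y j ≡ t) × W t ≡ M)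
        hit? t = hit t ×-dec (W t ≟ M)
        unhit? : Decidable (λ t → C t × ¬ ∃ λ j → y j ≡ t)
        unhit? t = C? t ×-dec ¬? (hit t)
        split : ∀ {t} → C t × W t ≡ M → Dec (∃ λ j → y j ≡ t) → _
        split (_ , e) (yes p) = inj₁ (p , e)
        split (p , _) (no ¬p) = inj₂ (p , ¬p)
        all : Decidable {A = Fin k} (λ _ → ⊤)
        all _ = yes tt
        k≤ : k ≤ # inY?
        k≤ = ≤-trans (#-all {P = λ _ → ⊤} all _) (#-injective all inY? y (λ {j} _ → j , refl) λ _ _ → y-inj)
        hit≤2 : # hit? ≤ 2
        hit≤2 = ≤-trans (#-fibres hit? (λ j → w j ≟ M) (λ t j → y j Fin.≟ t) (λ { ((j , refl) , e) → j , e , refl })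
            (λ {j} _ → #-≤1 (λ t → hit? t ×-dec (y j Fin.≟ t)) λ (_ , e) (_ , e′) → trans (sym e) e′))
          (≤-trans (≤-reflexive (*-identityʳ _)) (#heaviest≤2 3M<k))

      -- The landmark and its two sides in each card

      module Landmark (s : ℕ) (heavy : W (c s) ≡ M) (b : ℕ) (6<k : 6 < k) where

        a : Fin k → ℕ
        a i = pos s (y i)

        Elsewhere : Fin k → Set
        Elsewhere i = 0 < a i

        pos-s : pos s (c s) ≡ 0
        pos-s = trans (cong (pos s ∘ c) (sym (+-identityʳ s))) (pos-c s (<-trans (s≤s z≤n) 2<L))

        pos-inj : ∀ {u v} → C u → C v → pos s u ≡ pos s v → u ≡ v
        pos-inj p q e = trans (sym (c-pos s p)) (trans (cong (λ t → c (s + t)) e) (c-pos s q))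

        a-inj : ∀ {i j} → a i ≡ a j → i ≡ j
        a-inj {i} {j} e = y-inj (pos-inj (y-in i) (y-in j) e)

        cs≢y : ∀ {i} → Elsewhere i → c s ≢ y i
        cs≢y 0<a e = <⇒≢ 0<a (trans (sym pos-s) (cong (pos s) e))

        -- Deleting y i and the landmark c s leaves the piece at the landmark
        -- (side 0) and the two arcs before and after y i (sides 1 and 2).
        side : ℕ → ℕ → Fin 3
        side d zero = zero
        side d (suc p) with suc p <? d
        ... | yes _ = suc zero
        ... | no _  = suc (suc zero)

        -- `side` sends a positive deleted position to side 2, hence the separate exclusion of
        -- `y i`.
        Side : Fin 3 → Fin k → Fin n → Set
        Side t i u = (C u × u ≢ y i) × side (a i) (pos s u) ≡ t

        Side? : ∀ t i → Decidable (Side t i)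
        Side? t i u = (C? u ×-dec ¬? (u Fin.≟ y i)) ×-dec (side (a i) (pos s u) Fin.≟ t)

        S : Fin 3 → Fin k → Fin n → Set
        S t i v = Side t i (β i v)

        S? : ∀ t i → Decidable (S t i)
        S? t i v = Side? t i (β i v)

        z : Fin k → Fin n
        z i = from i (c s)

        side-low : ∀ {d p} → 0 < p → p < d → side d p ≡ suc zero
        side-low {d} {suc p} _ p<d with suc p <? d
        ... | yes _ = refl
        ... | no ¬q = ⊥-elim (¬q p<d)

        side-high : ∀ {d p} → 0 < p → d ≤ p → side d p ≡ suc (suc zero)
        side-high {d} {suc p} _ d≤p with suc p <? d
        ... | yes q = ⊥-elim (<⇒≱ q d≤p)
        ... | no _  = refl

        side-0 : ∀ {d p} → side d p ≡ zero → p ≡ 0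
        side-0 {p = zero} _ = refl
        side-0 {d} {suc p} e with suc p <? d
        side-0 {d} {suc p} () | yes _
        side-0 {d} {suc p} () | no _

        side-1 : ∀ {d p} → side d p ≡ suc zero → 0 < p × p < d
        side-1 {d} {suc p} e with suc p <? d
        ... | yes q = s≤s z≤n , q

        side-2 : ∀ {d p} → side d p ≡ suc (suc zero) → 0 < p × d ≤ p
        side-2 {d} {suc p} e with suc p <? d
        ... | no ¬q = s≤s z≤n , ≮⇒≥ ¬q

        side-convex : ∀ {d p q r t} → t ≢ zero → side d p ≡ t → side d q ≡ t → p ≤ r → r ≤ q → side d r ≡ t
        side-convex {t = zero} t≢ _ _ _ _ = ⊥-elim (t≢ refl)
        side-convex {t = suc zero} _ e e′ le le′ =
          side-low (<-≤-trans (proj₁ (side-1 e)) le) (≤-<-trans le′ (proj₂ (side-1 e′)))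
        side-convex {t = suc (suc zero)} _ e e′ le le′ =
          side-high (<-≤-trans (proj₁ (side-2 e)) le) (≤-trans (proj₂ (side-2 e)) le)

        S-B : ∀ {t i v} → S t i v → B i v
        S-B = proj₁

        B-S : ∀ {i v} → B i v → S (side (a i) (pos s (β i v))) i v
        B-S p = p , refl

        S-unique : ∀ {t t′ i v} → S t i v → S t′ i v → t ≡ t′
        S-unique (_ , e) (_ , e′) = trans (sym e) e′

        β-z : ∀ i → β i (z i) ≡ c s
        β-z i = trans (cong base (to-from i (c s))) (base-C (c-in s))

        S₀-β : ∀ {i v} → S zero i v → β i v ≡ c s
        S₀-β ((p , _) , e) = pos-inj p (c-in s) (trans (side-0 e) (sym pos-s))

        β-S₀ : ∀ {i v} → Elsewhere i → β i v ≡ c s → S zero i v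
        β-S₀ {i} o e = (subst C (sym e) (c-in s) , cs≢y o ∘ trans (sym e)) ,
                        trans (cong (side (a i) ∘ pos s) e) (cong (side (a i)) pos-s)

        z∈S₀ : ∀ {i} → Elsewhere i → S zero i (z i)
        z∈S₀ {i} o = β-S₀ o (β-z i)

        S-≢z : ∀ {t i v} → t ≢ zero → Elsewhere i → S t i v → v ≢ z i
        S-≢z t≢ o p refl = t≢ (S-unique p (z∈S₀ o))

        class : ∀ {t i v} → S t i v → Walk H (Side t i ∘ base) (to i v) (β i v)
        class {t} {i} p = walk-map (λ e → subst (Side t i) (sym e) p) (class-walk (proj₁ (proj₁ p)))

        Side-≢y : ∀ {t i u} → Side t i (base u) → u ≢ y i
        Side-≢y {i = i} ((_ , ne) , _) e = ne (trans (cong base e) (base-C (y-in i)))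

        Side-base : ∀ {t i u} → Side t i u → Side t i (base u)
        Side-base {t} {i} p@((q , _) , _) = subst (Side t i) (sym (base-C q)) p

        Between-Side : ∀ {i d e t} → (∀ {r} → d ≤ r → r ≤ e → side (a i) r ≡ t × r ≢ a i) → e < L →
                       ∀ {u} → Between s d e u → Side t i u
        Between-Side {i} ok e<L (r , d≤r , r≤e , refl) = (c-in (s + r) , λ eq → proj₂ (ok d≤r r≤e) (trans (sym (pos-c s r<L)) (cong (pos s) eq))) ,
            trans (cong (side (a i)) (pos-c s r<L)) (proj₁ (ok d≤r r≤e))
          where r<L = ≤-<-trans r≤e e<L

        S-walk : ∀ {t i u v} → t ≢ zero → S t i u → S t i v → Walk G (S t i) u v
        S-walk {t} {i} {u} {v} t≢ p q = pulled i Side-≢y id (class p ++ middle ++ reverse (class q))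
          where
          pu = pos s (β i u)
          pv = pos s (β i v)
          not-a : ∀ {v} → S t i v → pos s (β i v) ≢ a i
          not-a ((r , ne) , _) e = ne (pos-inj r (y-in i) e)
          arcs : ∀ {d e} → d ≤ e → e < L → side (a i) d ≡ t → side (a i) e ≡ t → d ≢ a i → Walk H (Side t i ∘ base) (c (s + d)) (c (s + e))
          arcs {d} {e} d≤e e<L eq eq′ ne = walk-map (λ {u} bt → Side-base (Between-Side ok e<L bt)) (between s d≤e)
            where
            ok : ∀ {r} → d ≤ r → r ≤ e → side (a i) r ≡ t × r ≢ a i
            ok {r} d≤r r≤e = side-convex t≢ eq eq′ d≤r r≤e , λ { refl → cut t eq eq′ d≤r r≤e }
              where
              -- The deleted position lies beyond side 1 and is the least position of side 2, so an
              -- arc could meet it only at its own start, which `ne` forbids.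
              cut : ∀ t → side (a i) d ≡ t → side (a i) e ≡ t → d ≤ a i → a i ≤ e → ⊥
              cut zero             eq eq′ _ le with refl ← side-0 {p = d} eq | refl ← side-0 {p = e} eq′ = ne (sym (n≤0⇒n≡0 le))
              cut (suc zero)       eq eq′ _ le = <⇒≱ (proj₂ (side-1 eq′)) le
              cut (suc (suc zero)) eq eq′ le _ = ne (≤-antisym le (proj₂ (side-2 eq)))
          middle : Walk H (Side t i ∘ base) (β i u) (β i v)
          middle with ≤-total pu pv
          ... | inj₁ le = subst₂ (Walk H _) (c-pos s (proj₁ (proj₁ p))) (c-pos s (proj₁ (proj₁ q)))
                (arcs le (pos<L s (proj₁ (proj₁ q))) (proj₂ p) (proj₂ q) (not-a p))
          ... | inj₂ le = reverse (subst₂ (Walk H _) (c-pos s (proj₁ (proj₁ q))) (c-pos s (proj₁ (proj₁ p)))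
                (arcs le (pos<L s (proj₁ (proj₁ p))) (proj₂ q) (proj₂ p) (not-a q)))

        to-z : ∀ {t i v} → Elsewhere i → S t i v → Walk G (λ u → S t i u ⊎ u ≡ z i) v (z i)
        to-z {t} {i} {v} o p = pulled i ≢y back (subst (Walk H Q (to i v)) (sym (to-from i (c s)))
            (walk-map inj₁ (class p) ++ arm t refl))
          where
          Q : Fin n → Set
          Q u = Side t i (base u) ⊎ u ≡ c s
          ≢y : ∀ {u} → Q u → u ≢ y i
          ≢y (inj₁ q)    = Side-≢y q
          ≢y (inj₂ refl) = cs≢y o
          back : ∀ {u} → Q (to i u) → S t i u ⊎ u ≡ z i
          back (inj₁ q) = inj₁ q
          back {u} (inj₂ e) = inj₂ (trans (sym (from-to i u)) (cong (from i) e))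
          q = pos s (β i v)
          q∈C = proj₁ (proj₁ p)
          arm : ∀ t′ → t′ ≡ t → Walk H Q (β i v) (c s)
          arm zero refl = subst (Walk H Q (β i v)) (S₀-β p) (done (inj₁ (Side-base p)))
          arm (suc zero) refl = reverse (subst₂ (Walk H Q) (cong c (+-identityʳ s)) (c-pos s q∈C)
              (walk-map (λ bt → near bt) (between s {0} {q} z≤n)))
            where
            near : ∀ {u} → Between s 0 q u → Q u
            near (zero , _ , _ , refl) = inj₂ (cong c (+-identityʳ s))
            near (suc r , _ , le , e) = inj₁ (Side-base (Between-Side {d = 1} {q}
              (λ lo hi → let lt = ≤-<-trans hi (proj₂ (side-1 (proj₂ p))) in side-low lo lt , <⇒≢ lt)
              (pos<L s q∈C) (suc r , s≤s z≤n , le , e)))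
          -- Side 1 goes back to the landmark at offset 0; side 2 goes on to offset L, where the
          -- cycle closes.
          arm (suc (suc zero)) refl = subst₂ (Walk H Q) (c-pos s q∈C) (c-period s)
              (walk-map (λ bt → near bt) (between s {q} {L} (<⇒≤ (pos<L s q∈C))))
            where
            a<q : a i < q
            a<q = ≤∧≢⇒< (proj₂ (side-2 {d = a i} (proj₂ p))) λ e → proj₂ (proj₁ p) (pos-inj q∈C (y-in i) (sym e))
            near : ∀ {u} → Between s q L u → Q u
            near (r , lo , hi , e) with m≤n⇒m<n∨m≡n hi
            ... | inj₂ refl = inj₂ (trans e (c-period s))
            ... | inj₁ r<L = inj₁ (Side-base (Between-Side {d = q} {r}
                  (λ lo _ → side-high (<-≤-trans (<-trans o a<q) lo) (≤-trans (<⇒≤ a<q) lo) , (λ e → <⇒≢ (<-≤-trans a<q lo) (sym e)))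
                  r<L (r , lo , ≤-refl , e)))

        -- Each vertex is joined, within its side and without `z i`, to a neighbour of `z i`. The
        -- two neighbours are on different sides and so differ, and `forest-separates` applies.
        separated : ∀ {t t′ i u v} → Elsewhere i → S t i u → S t′ i v → t ≢ t′ → ¬ Walk G (_≢ z i) u v
        separated {t} {t′} {i} o p q t≢ r =
          let (w₁ , s₁ , e₁ , r₁) = neighbour p (walk-head r)
              (w₂ , s₂ , e₂ , r₂) = neighbour q (walk-last r)
          in forest-separates forest (flip-adj {X = G} e₁) (flip-adj {X = G} e₂)
               (λ e → t≢ (S-unique s₁ (subst (S t′ i) (sym e) s₂))) (reverse r₁ ++ r ++ r₂)
          where
          neighbour : ∀ {t v} → S t i v → v ≢ z i → ∃ λ w → S t i w × adj G w (z i) ≡ true × Walk G (_≢ z i) v w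
          neighbour p ne with last-step (to-z o p) ne
          ... | w , inj₁ sw , _ , e , r = w , sw , e , walk-map proj₂ r
          ... | w , inj₂ eq , w≢ , _ = ⊥-elim (w≢ eq)

        z∈G₀ : ∀ {i} → Elsewhere i → G₀ (z i)
        z∈G₀ o = B⊆G₀ (S-B (z∈S₀ o))

        hit : ∀ {i j v} → Elsewhere i → z i ≢ z j → G₀ v → Walk G (_≢ z i) v (z j) ⊎ Walk G (_≢ z j) v (z i)
        hit o ne p = first-hit ne (G₀-walk p (z∈G₀ o))

        #S : ∀ t i → # (S? t i) ≡ # (λ v → Side? t i (base v))
        #S t i = #β i (Side? t i)

        #S₀ : ∀ {i} → Elsewhere i → # (S? zero i) ≡ M
        #S₀ {i} o = trans (≤-antisym (#-mono (S? zero i) (λ v → β i v Fin.≟ c s) S₀-β) (#-mono (λ v → β i v Fin.≟ c s) (S? zero i) (β-S₀ o)))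
                      (trans (#β i (Fin._≟ c s)) heavy)

        -- A path vertex corresponds to a vertex of C, which is its own base, so only `z i` can be
        -- on side 0.
        P-side : ∀ {i u} → P i u → u ≢ z i → ∃ λ t → t ≢ zero × S t i u
        P-side {i} {u} p ne = _ , (λ e → ne (trans (sym (from-to i u)) (cong (from i)
            (trans (sym (base-C (proj₁ p))) (S₀-β {i} (proj₁ (B-S (P⊆B p)) , e)))))) , B-S (P⊆B p)

        #S≥ : ∀ t i d ℓ → d + ℓ ≤ L → (∀ {r} → d ≤ r → r < d + ℓ → side (a i) r ≡ t × r ≢ a i) → ℓ ≤ # (S? t i)
        #S≥ t i d ℓ le ok = ≤-trans (#-all {P = λ _ → ⊤} all _) (#-injective all (S? t i) (λ r → from i (c (s + (d + toℕ r))))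
            (λ {r} _ → subst (λ u → Side t i (base u)) (sym (to-from i _)) (Side-base (Between-Side {d = d + toℕ r} {d + toℕ r}
              (λ lo hi → ok (≤-trans (m≤m+n d _) lo) (≤-<-trans hi (+-monoʳ-< d (Fin.toℕ<n r)))) (<L r)
              (d + toℕ r , ≤-refl , ≤-refl , refl))))
            λ {r} {r′} _ _ e → Fin.toℕ-injective (+-cancelˡ-≡ d _ _ (c-distinct s (<L r) (<L r′) (from-injective i e))))
          where
          all : Decidable {A = Fin ℓ} (λ _ → ⊤)
          all _ = yes tt
          <L : ∀ (r : Fin ℓ) → d + toℕ r < L
          <L r = <-≤-trans (+-monoʳ-< d (Fin.toℕ<n r)) le

        #S₁≥ : ∀ {i R} → R < a i → R ≤ # (S? (suc zero) i)
        #S₁≥ {i} {R} R<a = #S≥ (suc zero) i 1 R (≤-trans R<a (<⇒≤ (pos<L s (y-in i))))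
          λ lo hi → let lt = <-≤-trans hi R<a in side-low lo lt , <⇒≢ lt

        #S₂≥ : ∀ {i R} → a i + R < L → R ≤ # (S? (suc (suc zero)) i)
        #S₂≥ {i} {R} lt = #S≥ (suc (suc zero)) i (suc (a i)) R lt
          λ lo hi → side-high (≤-trans (s≤s z≤n) lo) (<⇒≤ lo) , λ e → <⇒≢ lo (sym e)

        -- The deleted vertex is light and more than R steps away from the landmark in both
        -- directions, which leaves at least R cycle vertices on each side.
        record Far (R : ℕ) (i : Fin k) : Set where
          constructor far
          field
            light : w i ≤ b
            low   : R < a i
            high  : a i + R < L

        far? : ∀ R → Decidable (Far R)
        far? R i with w i ≤? b | R <? a i | a i + R <? L
        ... | yes p | yes q | yes r = yes (far p q r)
        ... | no ¬p | _ | _ = no (¬p ∘ Far.light)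
        ... | _ | no ¬q | _ = no (¬q ∘ Far.low)
        ... | _ | _ | no ¬r = no (¬r ∘ Far.high)

        far-elsewhere : ∀ {R i} → Far R i → Elsewhere i
        far-elsewhere f = ≤-<-trans z≤n (Far.low f)

        #S-far : ∀ {R i t} → Far R i → t ≢ zero → R ≤ # (S? t i)
        #S-far {t = zero} f t≢ = ⊥-elim (t≢ refl)
        #S-far {t = suc zero} f _ = #S₁≥ (Far.low f)
        #S-far {t = suc (suc zero)} f _ = #S₂≥ (Far.high f)

        -- The paths P i and P j meet, so that the piece at z j together with one of
        -- the sides of z j would fit into X i and the piece at z i.
        no-overlap : ∀ {i j v} → Far b i → Far b j → z i ≢ z j → S zero i v → S zero j v → ¬ Walk G (_≢ z i) v (z j)
        no-overlap {i} {j} {v} fi fj z≢ vi vj r = <⇒≱ (begin-strict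
            # rest? + # (X? i)
              <⟨ +-mono-<-≤ (#-< rest? (S? zero i) proj₁ (z i) (λ (_ , ne) → ne refl) (z∈S₀ oi)) (≤-trans (≤-reflexive (#X i)) (Far.light fi)) ⟩
            # (S? zero i) + b
              ≡⟨ cong (_+ b) (trans (#S₀ oi) (sym (#S₀ oj))) ⟩
            # (S? zero j) + b                                         ≤⟨ +-monoʳ-≤ _ (#S-far fj t″≢0) ⟩
            # (S? zero j) + # (S? t″ j)
              ≤⟨ #-disjoint (S? zero j) (S? t″ j) rest-X? (λ p → inside p (t′≢0 ∘ sym)) (λ p → inside p t″≢t′) (λ p q → t″≢0 (S-unique q p)) ⟩
            # rest-X?                                                 ≤⟨ #-cover rest? (X? i) rest-X? id ⟩
            # rest? + # (X? i)                                        ∎) ≤-refl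
          where
          open ≤-Reasoning
          oi = far-elsewhere fi
          oj = far-elsewhere fj
          rest? : Decidable (λ u → S zero i u × u ≢ z i)
          rest? u = S? zero i u ×-dec ¬? (u Fin.≟ z i)
          rest-X? : Decidable (λ u → (S zero i u × u ≢ z i) ⊎ X i u)
          rest-X? u = rest? u ⊎-dec X? i u
          away : ∀ {t u} → t ≢ zero → S t i u → ¬ Walk G (_≢ z i) u (z j)
          away t≢ p q = separated oi p vi t≢ (q ++ reverse r)
          towards : ∀ {u} → P i u → Walk G (_≢ z j) u (z i)
          towards {u} p = go (u Fin.≟ z i)
            where
            go : Dec (u ≡ z i) → Walk G (_≢ z j) u (z i)
            go (yes e) = subst (λ t → Walk G (_≢ z j) t (z i)) (sym e) (done z≢)
            go (no ne) = let (_ , t≢ , st) = P-side p ne in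
              [ ⊥-elim ∘ away t≢ st , id ]′ (hit oi z≢ (B⊆G₀ (P⊆B p)))
          common = P-meet i j
          u₀ = proj₁ common
          -- `ρ` joins the common path vertex `u₀` to `z i` without `z j`. So `z i` is cut off by
          -- `z j` from side 0 and from the side of card j opposite to that of `u₀`.
          ρ = towards (proj₁ (proj₂ common))
          t′ = proj₁ (P-side (proj₂ (proj₂ common)) (walk-head ρ))
          t′≢0 = proj₁ (proj₂ (P-side (proj₂ (proj₂ common)) (walk-head ρ)))
          u₀∈ = proj₂ (proj₂ (P-side (proj₂ (proj₂ common)) (walk-head ρ)))
          other : ∀ t → t ≢ zero → ∃ λ t″ → t″ ≢ zero × t″ ≢ t
          other zero t≢ = ⊥-elim (t≢ refl)
          other (suc zero) _ = suc (suc zero) , (λ ()) , λ ()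
          other (suc (suc zero)) _ = suc zero , (λ ()) , λ ()
          t″ = proj₁ (other t′ t′≢0)
          t″≢0 = proj₁ (proj₂ (other t′ t′≢0))
          t″≢t′ = proj₂ (proj₂ (other t′ t′≢0))
          to-zj : ∀ {t q} → S t j q → t ≢ t′ → Walk G (_≢ z i) q (z j)
          to-zj p t≢ = [ id , (λ r → ⊥-elim (separated oj p u₀∈ t≢ (r ++ reverse ρ))) ]′ (hit oi z≢ (B⊆G₀ (S-B p)))
          inside : ∀ {t q} → S t j q → t ≢ t′ → (S zero i q × q ≢ z i) ⊎ X i q
          inside {t} {q} p t≢ = go (B? i q)
            where
            at-E : ∀ t → S t i q → S zero i q × q ≢ z i
            at-E zero    sq = sq , walk-head (to-zj p t≢)
            at-E (suc _) sq = ⊥-elim (away (λ ()) sq (to-zj p t≢))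
            go : Dec (B i q) → _
            go (yes bq) = inj₁ (at-E _ (B-S bq))
            go (no ¬bq) = inj₂ (B⊆G₀ (S-B p) , ¬bq)

        -- A walk from the common vertex reaches one of two different landmarks first; `no-overlap`
        -- excludes both possibilities.
        same-landmark : ∀ {i j v} → Far b i → Far b j → S zero i v → S zero j v → z i ≡ z j
        same-landmark {i} {j} {v} fi fj vi vj with z i Fin.≟ z j
        ... | yes e = e
        ... | no ne with hit (far-elsewhere fi) ne (B⊆G₀ (S-B vi))
        ...   | inj₁ r = ⊥-elim (no-overlap fi fj ne vi vj r)
        ...   | inj₂ r = ⊥-elim (no-overlap fj fi (ne ∘ sym) vj vi r)

        -- A vertex of `S t j` is joined to `u` without the common landmark. If it lies in `B i`,
        -- `separated` keeps it on side t of card i; otherwise it is one of the `w i` vertices of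
        -- `X i`.
        side-size : ∀ {t i j u} → t ≢ zero → Elsewhere i → Elsewhere j → z i ≡ z j → S t i u → S t j u →
                  # (S? t j) ≤ # (S? t i) + w i
        side-size {t} {i} {j} {u} t≢ oi oj e p q = ≤-trans (#-cover (S? t i) (X? i) (S? t j) (λ {v} sv → go sv (B? i v)))
            (+-monoʳ-≤ _ (≤-reflexive (#X i)))
          where
          go : ∀ {v} → S t j v → Dec (B i v) → S t i v ⊎ X i v
          go sv (no ¬bv) = inj₂ (B⊆G₀ (S-B sv) , ¬bv)
          go {v} sv (yes bv) = at (side (a i) (pos s (β i v)) Fin.≟ t)
            where
            at : Dec (side (a i) (pos s (β i v)) ≡ t) → _
            at (yes eq) = inj₁ (bv , eq)
            at (no ne)  = ⊥-elim (separated oi (B-S bv) p ne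
              (subst (λ ζ → Walk G (_≢ ζ) v u) (sym e) (walk-map (S-≢z t≢ oj) (S-walk t≢ sv q))))

        -- Measured in H, the side before `y j` contains the side before `y i` and everything
        -- hanging on `y i`.
        grow₁ : ∀ {i j} → Elsewhere i → a i < a j → # (S? (suc zero) i) + w i ≤ # (S? (suc zero) j)
        grow₁ {i} {j} o lt = subst₂ (λ p q → p + w i ≤ q) (sym (#S (suc zero) i)) (sym (#S (suc zero) j))
          (#-disjoint (λ v → Side? (suc zero) i (base v)) (λ v → base v Fin.≟ y i) (λ v → Side? (suc zero) j (base v))
            (λ ((p , _) , e) → let (0<p , p<a) = side-1 e in (p , λ eq → <⇒≢ (<-trans p<a lt) (cong (pos s) eq)) , side-low 0<p (<-trans p<a lt))
            (λ e → subst (Side (suc zero) j) (sym e) ((y-in i , λ eq → <⇒≢ lt (cong (pos s) eq)) , side-low o lt))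
            λ ((_ , ne) , _) e → ne e)

        grow₂ : ∀ {i j} → Elsewhere i → a j < a i → # (S? (suc (suc zero)) i) + w i ≤ # (S? (suc (suc zero)) j)
        grow₂ {i} {j} o lt = subst₂ (λ p q → p + w i ≤ q) (sym (#S (suc (suc zero)) i)) (sym (#S (suc (suc zero)) j))
          (#-disjoint (λ v → Side? (suc (suc zero)) i (base v)) (λ v → base v Fin.≟ y i) (λ v → Side? (suc (suc zero)) j (base v))
            (λ {v} ((p , _) , e) → let (0<p , a≤p) = side-2 {a i} {pos s (base v)} e in
              (p , λ eq → <⇒≢ (<-≤-trans lt a≤p) (cong (pos s) (sym eq))) , side-high 0<p (≤-trans (<⇒≤ lt) a≤p))
            (λ e → subst (Side (suc (suc zero)) j) (sym e) ((y-in i , λ eq → <⇒≢ lt (cong (pos s) (sym eq))) , side-high o (<⇒≤ lt)))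
            λ ((_ , ne) , _) e → ne e)

        -- From i to l the side can grow by at most `w i`, by `side-size`, but passing two deleted
        -- vertices makes it grow by `w i` + `w j`.
        no-chain : ∀ {t i j l u} → t ≢ zero → Elsewhere i → Elsewhere l → z i ≡ z l → S t i u → S t l u →
                   # (S? t i) + w i ≤ # (S? t j) → # (S? t j) + w j ≤ # (S? t l) → ⊥
        no-chain {t} {i} {j} {l} t≢ oi ol e p q g₁ g₂ = <⇒≱ (begin-strict
            # (S? t l)          ≤⟨ side-size t≢ oi ol e p q ⟩
            # (S? t i) + w i    ≤⟨ g₁ ⟩
            # (S? t j)          <⟨ m<m+n _ (W≥1 j) ⟩
            # (S? t j) + w j    ≤⟨ g₂ ⟩
            # (S? t l)          ∎) ≤-refl
          where open ≤-Reasoning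

        Here : Fin n → Fin k → Set
        Here v i = Far b i × S zero i v

        here? : ∀ v → Decidable (Here v)
        here? v i = far? b i ×-dec S? zero i v

        halve : ∀ l → ∃ λ r → suc l ≤ 2 + (r + r) × r + r < suc l
        halve 0 = 0 , s≤s z≤n , s≤s z≤n
        halve 1 = 0 , s≤s (s≤s z≤n) , s≤s z≤n
        halve (suc (suc l)) = let (r , p , q) = halve l in
          suc r , s≤s (s≤s (≤-trans p (≤-reflexive (cong suc (sym (+-suc r r)))))) , s≤s (s≤s (≤-trans (≤-reflexive (+-suc r r)) q))

        half-L : ∃ λ r → L ≤ 2 + (r + r) × r + r < L
        half-L = subst (λ t → ∃ λ r → t ≤ 2 + (r + r) × r + r < t) (suc-pred L {{>-nonZero (<-trans (s≤s z≤n) 2<L)}}) (halve _)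

        -- This is (L - 1)/2 rounded down. The two sides share L - 2 cycle vertices, so one of them
        -- has at least `r₀`.
        r₀ : ℕ
        r₀ = proj₁ half-L

        wide? : ∀ t v → Decidable (λ i → Here v i × r₀ ≤ # (S? t i))
        wide? t v i = here? v i ×-dec (r₀ ≤? # (S? t i))

        -- By `no-chain` a vertex is on side t of at most two of these cards, so nine cards would
        -- give 9r₀ ≤ 2n. With n + 3 ≤ 2k ≤ 2L ≤ 4 + 4r₀ this forces r₀ ≤ 2 and L ≤ 6.
        #wide≤8 : ∀ t v → t ≢ zero → # (wide? t v) ≤ 8
        #wide≤8 t v t≢ = ≮⇒≥ λ 8< → <⇒≱ (≤-trans 6<k k≤L) (≤-trans (proj₁ (proj₂ half-L)) (+-monoʳ-≤ 2 (+-mono-≤ (small 8<) (small 8<))))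
          where
          open ≤-Reasoning
          chain : ∀ t → t ≢ zero → ∀ {u i j l} → Here v i × S t i u → Here v j × S t j u → Here v l × S t l u → a i < a j → a j < a l → ⊥
          chain zero t≢ = ⊥-elim (t≢ refl)
          chain (suc zero) t≢ ((fi , vi) , p) ((fj , _) , _) ((fl , vl) , q) lt lt′ =
            no-chain t≢ (far-elsewhere fi) (far-elsewhere fl) (same-landmark fi fl vi vl) p q (grow₁ (far-elsewhere fi) lt) (grow₁ (far-elsewhere fj) lt′)
          chain (suc (suc zero)) t≢ ((fi , vi) , p) ((fj , _) , _) ((fl , vl) , q) lt lt′ =
            no-chain t≢ (far-elsewhere fl) (far-elsewhere fi) (same-landmark fl fi vl vi) q p (grow₂ (far-elsewhere fl) lt′) (grow₂ (far-elsewhere fj) lt)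
          double : # (wide? t v) * r₀ ≤ n * 2
          double = #-double (wide? t v) (S? t) proj₂ λ u → ≤-trans
            (#-mono (λ i → wide? t v i ×-dec S? t i u) (λ i → here? v i ×-dec S? t i u) (λ ((p , _) , q) → p , q))
            (#-≤2 (λ i → here? v i ×-dec S? t i u)
              (sort₃ {P = λ i → Here v i × S t i u} a (λ _ _ → a-inj) (chain t t≢)))
          n≤ : 3 + n ≤ 4 + r₀ * 4
          n≤ = begin
            3 + n                                    ≤⟨ half ⟩
            k + k
              ≤⟨ +-mono-≤ (≤-trans k≤L (proj₁ (proj₂ half-L))) (≤-trans k≤L (proj₁ (proj₂ half-L))) ⟩
            (2 + (r₀ + r₀)) + (2 + (r₀ + r₀))        ≡⟨ eq r₀ ⟩
            4 + r₀ * 4                               ∎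
            where
            eq : ∀ r → (2 + (r + r)) + (2 + (r + r)) ≡ 4 + r * 4
            eq = solve-∀
          small : 8 < # (wide? t v) → r₀ ≤ 2
          small 8< = +-cancelˡ-≤ (6 + 8 * r₀) _ _ (begin
            6 + 8 * r₀ + r₀                ≡⟨ eq₁ r₀ ⟩
            6 + 9 * r₀                     ≤⟨ +-monoʳ-≤ 6 (≤-trans (*-monoˡ-≤ r₀ 8<) double) ⟩
            6 + n * 2                      ≡⟨ eq₂ n ⟩
            (3 + n) * 2                    ≤⟨ *-monoˡ-≤ 2 n≤ ⟩
            (4 + r₀ * 4) * 2               ≡⟨ eq₃ r₀ ⟩
            6 + 8 * r₀ + 2                 ∎)
            where
            eq₁ : ∀ r → 6 + 8 * r + r ≡ 6 + 9 * r
            eq₁ = solve-∀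
            eq₂ : ∀ n → 6 + n * 2 ≡ (3 + n) * 2
            eq₂ = solve-∀
            eq₃ : ∀ r → (4 + r * 4) * 2 ≡ 6 + 8 * r + 2
            eq₃ = solve-∀

        #here≤16 : ∀ v → # (here? v) ≤ 16
        #here≤16 v = ≤-trans (#-cover (wide? (suc zero) v) (wide? (suc (suc zero)) v) (here? v)
            (λ {i} p → split p (far-elsewhere (proj₁ p)) (r₀ ≤? # (S? (suc zero) i)) (r₀ ≤? # (S? (suc (suc zero)) i))))
          (+-mono-≤ (#wide≤8 (suc zero) v λ ()) (#wide≤8 (suc (suc zero)) v λ ()))
          where
          open ≤-Reasoning
          split : ∀ {i} → Here v i → Elsewhere i → Dec (r₀ ≤ # (S? (suc zero) i)) → Dec (r₀ ≤ # (S? (suc (suc zero)) i)) →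
                  (Here v i × r₀ ≤ # (S? (suc zero) i)) ⊎ (Here v i × r₀ ≤ # (S? (suc (suc zero)) i))
          split p _ (yes q) _ = inj₁ (p , q)
          split p _ _ (yes q) = inj₂ (p , q)
          split {i} p o (no ¬p) (no ¬q) = ⊥-elim (<⇒≱ (proj₂ (proj₂ half-L)) (begin
            L                                ≡⟨ sym (m+[n∸m]≡n a<L) ⟩
            suc (a i) + ρ                    ≡⟨ cong (λ t → suc t + ρ) (sym (suc-pred (a i) {{>-nonZero o}})) ⟩
            suc (suc α) + ρ                  ≡⟨ cong suc (sym (+-suc α ρ)) ⟩
            suc α + suc ρ
              ≤⟨ +-mono-≤ (≤-<-trans (#S₁≥ (≤-reflexive (suc-pred (a i) {{>-nonZero o}}))) (≰⇒> ¬p))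
                                                         (≤-<-trans (#S₂≥ (≤-reflexive (m+[n∸m]≡n a<L))) (≰⇒> ¬q)) ⟩
            r₀ + r₀                          ∎))
            where
            a<L = pos<L s (y-in i)
            ρ = L ∸ suc (a i)
            α = pred (a i)

        #far*M≤16n : # (far? b) * M ≤ n * 16
        #far*M≤16n = #-double (far? b) (S? zero) (λ f → ≤-reflexive (sym (#S₀ (far-elsewhere f)))) #here≤16

        B-along : ∀ {i u v} → Walk G (_≢ x i) u v → B i u → B i v
        B-along r p = proj₂ (walk-last (walk-closed (λ _ q e → B-closed q e) r p))

        -- `e` and `y i` cut C into two arcs. Both bases lie on the same one and are joined along
        -- it.
        same-side-walk : ∀ {i u v e} → B i u → B i v → e ≢ β i u → e ≢ β i v →
                   let q = pos (proj₁ (c-window 0 (y-in i))) in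
                   (q (β i u) < q e × q (β i v) < q e) ⊎ (q e < q (β i u) × q e < q (β i v)) →
                   C e → Walk G (λ t → to i t ≢ e) u v
        same-side-walk {i} {u} {v} {e} p@(u∈ , u≢) q@(v∈ , v≢) e≢u e≢v same e∈ =
            walk-map (class≢ e≢u) (class-walk-to p) ++ middle (≤-total (f u) (f v)) ++ reverse (walk-map (class≢ e≢v) (class-walk-to q))
          where
          a₀ : ℕ
          a₀ = proj₁ (c-window 0 (y-in i))
          ca : c a₀ ≡ y i
          ca = proj₂ (proj₂ (c-window 0 (y-in i)))
          f : Fin n → ℕ
          f t = pos a₀ (β i t)
          class≢ : ∀ {u} → e ≢ β i u → ∀ {t} → β i t ≡ β i u → to i t ≢ e
          class≢ ne eq refl = ne (trans (sym (base-C e∈)) eq)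
          apart : (f u < pos a₀ e × f v < pos a₀ e) ⊎ (pos a₀ e < f u × pos a₀ e < f v) →
                  ∀ {r} → (f u ≤ r × r ≤ f v) ⊎ (f v ≤ r × r ≤ f u) → r ≢ pos a₀ e
          apart (inj₁ (_ , lt)) (inj₁ (_ , le)) refl = <⇒≱ lt le
          apart (inj₁ (lt , _)) (inj₂ (_ , le)) refl = <⇒≱ lt le
          apart (inj₂ (lt , _)) (inj₁ (le , _)) refl = <⇒≱ lt le
          apart (inj₂ (_ , lt)) (inj₂ (le , _)) refl = <⇒≱ lt le
          part : ∀ {u v} → B i u → B i v → f u ≤ f v → (∀ {r} → f u ≤ r → r ≤ f v → r ≢ pos a₀ e) →
                 Walk G (λ t → to i t ≢ e) (from i (β i u)) (from i (β i v))
          part {u} {v} (u∈ , u≢) (v∈ , _) le ok = walk-map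
            (λ { (r , lo , hi , eq) refl → ok lo hi (sym (trans (cong (pos a₀) eq) (pos-c a₀ (≤-<-trans hi (pos<L a₀ v∈))))) })
            (subst₂ (λ s t → Walk G (λ t → Between a₀ (f u) (f v) (to i t)) (from i s) (from i t)) (c-pos a₀ u∈) (c-pos a₀ v∈)
              (pull i (between-≢ ca (pos-≢ ca u∈ u≢) (pos<L a₀ v∈)) (between a₀ le)))
          middle : f u ≤ f v ⊎ f v ≤ f u → Walk G (λ t → to i t ≢ e) (from i (β i u)) (from i (β i v))
          middle (inj₁ le) = part p q le λ lo hi → apart same (inj₁ (lo , hi))
          middle (inj₂ le) = reverse (part q p le λ lo hi → apart same (inj₂ (lo , hi)))

        -- The landmark of card i seen in a reference card r

        module Reference {R : ℕ} (big : 1 + M + b ≤ R) {i r : Fin k} (fi : Far R i) (fr : Far R r) (free : ¬ S zero i (x r)) where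

          o : Elsewhere i
          o = far-elsewhere fi

          z≢x : z i ≢ x r
          z≢x e = free (subst (S zero i) e (z∈S₀ o))

          #X≤b : # (X? r) ≤ b
          #X≤b = ≤-trans (≤-reflexive (#X r)) (Far.light fr)

          b<R : b < R
          b<R = ≤-trans (s≤s (m≤n+m b M)) big

          avoids : ∀ {t v} → ¬ S t i (x r) → S t i v → Walk G (_≢ x r) v (z i)
          avoids {t} ¬x p = walk-map (λ { (inj₁ q) refl → ¬x q ; (inj₂ eq) eq′ → z≢x (trans (sym eq) eq′) }) (to-z o p)

          -- The side is joined to `z i` off `x r` and would fall into `X r` with it, but it has at
          -- least R > b vertices.
          absorbed : ∀ {t} → t ≢ zero → ¬ S t i (x r) → ¬ B r (z i) → ⊥
          absorbed {t} t≢ ¬x ¬bz = <⇒≱ b<R (≤-trans (#S-far fi t≢) (≤-trans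
            (#-mono (S? t i) (X? r) (λ p → B⊆G₀ (S-B p) , λ bp → ¬bz (B-along (avoids ¬x p) bp))) #X≤b))

          z∈B : B r (z i)
          z∈B = go (B? r (z i)) (S? (suc zero) i (x r))
            where
            go : Dec (B r (z i)) → Dec (S (suc zero) i (x r)) → B r (z i)
            go (yes p) _ = p
            go (no ¬p) (no ¬q) = ⊥-elim (absorbed (λ ()) ¬q ¬p)
            go (no ¬p) (yes q) = ⊥-elim (absorbed {suc (suc zero)} (λ ()) (λ q′ → clash (S-unique q q′)) ¬p)
              where
              clash : ¬ (suc zero ≡ suc (suc zero))
              clash ()

          e : Fin n
          e = β r (z i)

          e∈C : C e
          e∈C = proj₁ z∈B

          M≤#S : ∀ t → M ≤ # (S? t i)
          M≤#S zero    = ≤-reflexive (sym (#S₀ o))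
          M≤#S (suc t) = ≤-trans (≤-trans (m≤m+n M b) (≤-trans (n≤1+n _) big)) (#S-far fi λ ())

          -- Were the landmark of card i off the cycle in card r, the piece of r
          -- containing it would swallow one of its sides or its own piece.
          swallowed : ¬ C (to r (z i)) → ∀ t → ¬ S t i (x r) → ¬ S t i (from r e) → ⊥
          swallowed ¬c t ¬x ¬e = <⇒≱ (<-≤-trans
              (#-< (S? t i) (λ v → β r v Fin.≟ e) (proj₁ ∘ hung) (from r e) ¬e (trans (cong base (to-from r e)) (base-C e∈C)))
              (≤-trans (≤-reflexive (#β r (Fin._≟ e))) (W≤M e∈C))) (M≤#S t)
            where
            Hung : Fin n → Set
            Hung v = β r v ≡ e × ¬ C (to r v)
            z≢e : z i ≢ from r e
            z≢e eq = ¬c (subst C (sym (trans (cong (to r) eq) (to-from r e))) e∈C)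
            walk : ∀ {v} → S t i v → Walk G (λ u → u ≢ x r × u ≢ from r e) v (z i)
            walk p = walk-map (λ { (inj₁ q) → (λ { refl → ¬x q }) , (λ { refl → ¬e q })
                                 ; (inj₂ eq) → (λ eq′ → z≢x (trans (sym eq) eq′)) , (λ eq′ → z≢e (trans (sym eq) eq′)) }) (to-z o p)
            hung : ∀ {v} → S t i v → Hung v
            hung p = proj₂ (walk-last (walk-closed closed (reverse (walk p)) (refl , ¬c)))
              where
              closed : ∀ {u v} → u ≢ x r × u ≢ from r e → v ≢ x r × v ≢ from r e → adj G u v ≡ true → Hung u → Hung v
              closed {u} {v} (u≢ , _) (v≢ , v≢e) uv (eq , ¬cu) = eq′ ,
                  λ cv → v≢e (trans (sym (from-to r v)) (cong (from r) (trans (sym (base-C cv)) eq′)))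
                where
                eq′ : β r v ≡ e
                eq′ = trans (base-edge (to-adj u≢ v≢ uv) (¬cu ∘ proj₁) (subst C (sym eq) e∈C)) eq

          -- `swallowed` needs a side containing neither `x r` nor the root `from r e`. Side 0
          -- serves unless the root is there; in that case sides 1 and 2 are free of the root, and
          -- `x r` misses one of them.
          on-cycle : C (to r (z i))
          on-cycle = go (C? (to r (z i))) (S? zero i (from r e)) (S? (suc zero) i (x r))
            where
            go : Dec (C (to r (z i))) → Dec (S zero i (from r e)) → Dec (S (suc zero) i (x r)) → C (to r (z i))
            go (yes p) _ _ = p
            go (no ¬p) (no ¬q) _ = ⊥-elim (swallowed ¬p zero free ¬q)
            go (no ¬p) (yes q) (no ¬u) = ⊥-elim (swallowed ¬p (suc zero) ¬u λ q′ → clash (S-unique q q′))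
              where
              clash : ¬ (zero ≡ suc zero)
              clash ()
            go (no ¬p) (yes q) (yes u) = ⊥-elim (swallowed ¬p (suc (suc zero)) (λ u′ → clash (S-unique u u′)) λ q′ → clash′ (S-unique q q′))
              where
              clash : ¬ (suc zero ≡ suc (suc zero))
              clash ()
              clash′ : ¬ (zero ≡ suc (suc zero))
              clash′ ()

          to-z≡e : to r (z i) ≡ e
          to-z≡e = sym (base-C on-cycle)

          a₀ : ℕ
          a₀ = proj₁ (c-window 0 (y-in r))

          Good : Fin n → Set
          Good v = B r v × e ≢ β r v

          good? : Decidable Good
          good? v = B? r v ×-dec ¬? (e Fin.≟ β r v)

          -- The side has at least R > M + b vertices; at most M of them hang on `e` in card r and
          -- at most b lie in `X r`.
          good-in : ∀ {t} → t ≢ zero → ∃ λ v → S t i v × Good v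
          good-in {t} t≢ = #-witness (λ v → S? t i v ×-dec good? v) (+-cancelˡ-≤ (M + b) _ _ (begin
              M + b + 1                                                       ≡⟨ +-comm (M + b) 1 ⟩
              1 + M + b                                                       ≤⟨ big ⟩
              R                                                               ≤⟨ #S-far fi t≢ ⟩
              # (S? t i)
                ≤⟨ #-cover same? rest? (S? t i) (λ {v} p → split p (B? r v) (e Fin.≟ β r v)) ⟩
              # same? + # rest?
                ≤⟨ +-mono-≤ (≤-trans (≤-reflexive (#β r (e Fin.≟_))) few) (#-cover (X? r) (λ v → S? t i v ×-dec good? v) rest? id) ⟩
              M + (# (X? r) + # (λ v → S? t i v ×-dec good? v))               ≤⟨ +-monoʳ-≤ M (+-monoˡ-≤ _ #X≤b) ⟩
              M + (b + # (λ v → S? t i v ×-dec good? v))                      ≡⟨ sym (+-assoc M b _) ⟩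
              M + b + # (λ v → S? t i v ×-dec good? v)                        ∎))
            where
            open ≤-Reasoning
            same? : Decidable (λ v → e ≡ β r v)
            same? v = e Fin.≟ β r v
            rest? : Decidable (λ v → X r v ⊎ (S t i v × Good v))
            rest? v = X? r v ⊎-dec (S? t i v ×-dec good? v)
            few : # (λ v → e Fin.≟ base v) ≤ M
            few = ≤-trans (#-mono (λ v → e Fin.≟ base v) (λ v → base v Fin.≟ e) sym) (W≤M e∈C)
            split : ∀ {v} → S t i v → Dec (B r v) → Dec (e ≡ β r v) → e ≡ β r v ⊎ (X r v ⊎ (S t i v × Good v))
            split p _ (yes eq) = inj₁ eq
            split p (no ¬q) _ = inj₂ (inj₁ (B⊆G₀ (S-B p) , ¬q))
            split p (yes q) (no ne) = inj₂ (inj₂ (p , q , ne))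

          ψ : Fin n → ℕ
          ψ v = pos a₀ (β r v)

          Low High : Fin n → Set
          Low v  = ψ v < pos a₀ e
          High v = pos a₀ e < ψ v

          low-or-high : ∀ {v} → Good v → Low v ⊎ High v
          low-or-high {v} (p , ne) with <-cmp (ψ v) (pos a₀ e)
          ... | tri< lt _ _ = inj₁ lt
          ... | tri> _ _ gt = inj₂ gt
          ... | tri≈ _ eq _ = ⊥-elim (ne (trans (sym (c-pos a₀ e∈C)) (trans (cong (λ t → c (a₀ + t)) (sym eq)) (c-pos a₀ (proj₁ p)))))

          apart : ∀ {t t′ u v} → t ≢ t′ → S t i u × Good u → S t′ i v × Good v → (Low u × Low v) ⊎ (High u × High v) → ⊥
          apart t≢ (p , bu , eu) (q , bv , ev) same = separated o p q t≢
            (walk-map (λ ne eq → ne (trans (cong (to r) eq) to-z≡e)) (same-side-walk bu bv eu ev same e∈C))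

          -- `e` and `y r` leave only two arcs of C, so two of the three vertices would be joined
          -- without `e`, which is `z i` in card r, although `z i` separates their sides.
          no-three : ∀ {v₀ v₁ v₂} → S zero i v₀ × Good v₀ → S (suc zero) i v₁ × Good v₁ → S (suc (suc zero)) i v₂ × Good v₂ → ⊥
          no-three p₀ p₁ p₂ with low-or-high (proj₂ p₀) | low-or-high (proj₂ p₁) | low-or-high (proj₂ p₂)
          ... | inj₁ l | inj₁ l′ | _       = apart (λ ()) p₀ p₁ (inj₁ (l , l′))
          ... | inj₁ l | inj₂ _  | inj₁ l′ = apart (λ ()) p₀ p₂ (inj₁ (l , l′))
          ... | inj₁ _ | inj₂ g  | inj₂ g′ = apart (λ ()) p₁ p₂ (inj₂ (g , g′))
          ... | inj₂ _ | inj₁ l  | inj₁ l′ = apart (λ ()) p₁ p₂ (inj₁ (l , l′))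
          ... | inj₂ g | inj₁ _  | inj₂ g′ = apart (λ ()) p₀ p₂ (inj₂ (g , g′))
          ... | inj₂ g | inj₂ g′ | _       = apart (λ ()) p₀ p₁ (inj₂ (g , g′))

          -- A vertex of the landmark piece hanging elsewhere would, with those of `good-in`, make
          -- three good vertices on three sides.
          piece : ∀ {v} → S zero i v → β r v ≡ e
          piece {v} p = go (e Fin.≟ β r v)
            where
            bv : B r v
            bv = B-along (reverse (avoids free p)) z∈B
            go : Dec (e ≡ β r v) → β r v ≡ e
            go (yes eq) = sym eq
            go (no ne) = let (_ , q₁) = good-in {suc zero} (λ ()) ; (_ , q₂) = good-in {suc (suc zero)} (λ ()) in
              ⊥-elim (no-three (p , bv , ne) q₁ q₂)

          heaviest : W (to r (z i)) ≡ M
          heaviest = trans (cong W to-z≡e) (≤-antisym (W≤M e∈C) (begin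
            M                               ≡⟨ sym (#S₀ o) ⟩
            # (S? zero i)                   ≤⟨ #-mono (S? zero i) (λ v → β r v Fin.≟ e) piece ⟩
            # (λ v → β r v Fin.≟ e)         ≡⟨ #β r (Fin._≟ e) ⟩
            W e                             ∎))
            where open ≤-Reasoning

        -- The final count

        heavy? : Decidable (λ i → b < w i)
        heavy? i = b <? w i

        #heavy : # heavy? * b + k ≤ n
        #heavy = begin
          # heavy? * b + k
            ≡⟨ cong₂ _+_ (sym (sum-*ˡ (λ i → ind (heavy? i)) b)) (sym (trans (sum-const k 1) (*-identityʳ k))) ⟩
          sum (λ i → ind (heavy? i) * b) + sum {k} (λ _ → 1)
            ≡⟨ sym (∑-distrib-+ (λ i → ind (heavy? i) * b) (λ _ → 1)) ⟩
          sum (λ i → ind (heavy? i) * b + 1)              ≤⟨ sum-mono (λ i → weigh (heavy? i) (W≥1 i)) ⟩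
          sum w                                           ≤⟨ w≤n ⟩
          n                                               ∎
          where
          open ≤-Reasoning
          weigh : ∀ {ω} (d : Dec (b < ω)) → 1 ≤ ω → ind d * b + 1 ≤ ω
          weigh (yes p) _ = ≤-trans (≤-reflexive (trans (cong (_+ 1) (+-identityʳ b)) (+-comm b 1))) p
          weigh (no _)  q = q

        -- An index that is not far is heavy or has its deleted vertex at one of the R + 1 offsets
        -- 0, ..., R or the R offsets L - R, ..., L - 1.
        k≤far : ∀ R → k ≤ # (far? R) + (# heavy? + (suc R + R))
        k≤far R = begin
          k                                                        ≤⟨ #-all {P = λ _ → ⊤} all _ ⟩
          # all
            ≤⟨ #-cover (far? R) notfar? all (λ {i} _ → split (w i ≤? b) (R <? a i) (a i + R <? L)) ⟩
          # (far? R) + # notfar?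
            ≤⟨ +-monoʳ-≤ (# (far? R)) (≤-trans (#-cover heavy? ends? notfar? id) (+-monoʳ-≤ (# heavy?) (≤-trans (#-cover low? high? ends? id) (+-mono-≤ #low #high)))) ⟩
          # (far? R) + (# heavy? + (suc R + R))                    ∎
          where
          open ≤-Reasoning
          all : Decidable {A = Fin k} (λ _ → ⊤)
          all _ = yes tt
          low? : Decidable (λ i → a i ≤ R)
          low? i = a i ≤? R
          high? : Decidable (λ i → L ≤ a i + R)
          high? i = L ≤? a i + R
          ends? : Decidable (λ i → a i ≤ R ⊎ L ≤ a i + R)
          ends? i = low? i ⊎-dec high? i
          notfar? : Decidable (λ i → b < w i ⊎ (a i ≤ R ⊎ L ≤ a i + R))
          notfar? i = heavy? i ⊎-dec ends? i
          split : ∀ {i} → Dec (w i ≤ b) → Dec (R < a i) → Dec (a i + R < L) → Far R i ⊎ (b < w i ⊎ (a i ≤ R ⊎ L ≤ a i + R))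
          split (yes p) (yes q) (yes r) = inj₁ (far p q r)
          split (no ¬p) _ _ = inj₂ (inj₁ (≰⇒> ¬p))
          split _ (no ¬q) _ = inj₂ (inj₂ (inj₁ (≮⇒≥ ¬q)))
          split _ _ (no ¬r) = inj₂ (inj₂ (inj₂ (≮⇒≥ ¬r)))
          allR : ∀ R → Decidable {A = Fin R} (λ _ → ⊤)
          allR R _ = yes tt
          #low : # low? ≤ suc R
          #low = ≤-trans (#-fibres low? (allR (suc R)) (λ i t → a i ≟ toℕ t)
              (λ p → fromℕ< (s≤s p) , tt , sym (Fin.toℕ-fromℕ< (s≤s p)))
              (λ {t} _ → #-≤1 (λ i → low? i ×-dec (a i ≟ toℕ t)) λ (_ , e) (_ , e′) → a-inj (trans e (sym e′))))
            (≤-trans (≤-reflexive (*-identityʳ _)) (#-≤ (allR (suc R))))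
          #high : # high? ≤ R
          #high = ≤-trans (#-fibres high? (allR R) (λ i t → suc (a i) + toℕ t ≟ L)
              (λ {i} p → let a<L = pos<L s (y-in i)
                             lt = +-cancelˡ-< (a i) _ _ (≤-trans (≤-reflexive (m+[n∸m]≡n a<L)) p) in
                fromℕ< lt , tt , trans (cong (suc (a i) +_) (Fin.toℕ-fromℕ< lt)) (m+[n∸m]≡n a<L))
              (λ {t} _ → #-≤1 (λ i → high? i ×-dec (suc (a i) + toℕ t ≟ L)) λ (_ , e) (_ , e′) →
                a-inj (suc-injective (+-cancelʳ-≡ (toℕ t) _ _ (trans e (sym e′))))))
            (≤-trans (≤-reflexive (*-identityʳ _)) (#-≤ (allR R)))

        -- Any far card r serves as reference. At most 16 indices have `x r` in their landmark
        -- piece; for the others `z i` becomes a heaviest vertex of C, each one for at most 16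
        -- indices.
        #far≤ : ∀ {R} → 1 + M + b ≤ R → # (far? R) ≤ 16 + # (λ t → C? t ×-dec (W t ≟ M)) * 16
        #far≤ {R} big = go (0 <? # (far? R))
          where
          near : ∀ {i} → Far R i → Far b i
          near (far p q r) = far p (≤-<-trans b≤R q) (≤-<-trans (+-monoʳ-≤ _ b≤R) r)
            where
            b≤R : b ≤ R
            b≤R = ≤-trans (m≤n+m b (1 + M)) big
          go : Dec (0 < # (far? R)) → _
          go (no ¬p) = ≤-trans (≮⇒≥ ¬p) z≤n
          go (yes p) = let (r , fr) = #-witness (far? R) p in ≤-trans
            (#-cover (here? (x r)) (free? r) (far? R) (λ {i} f → split r f (S? zero i (x r))))
            (+-mono-≤ (#here≤16 (x r)) (#-fibres (free? r) (λ t → C? t ×-dec (W t ≟ M)) (λ i t → to r (z i) Fin.≟ t)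
              (λ (f , ¬s) → _ , (Reference.on-cycle big f fr ¬s , Reference.heaviest big f fr ¬s) , refl)
              (λ {t} _ → ≤-trans (#-mono (λ i → free? r i ×-dec (to r (z i) Fin.≟ t)) (here? (from r t))
                  λ {i} ((f , _) , e) → near f , subst (S zero i) (trans (sym (from-to r (z i))) (cong (from r) e)) (z∈S₀ (far-elsewhere f)))
                (#here≤16 (from r t)))))
            where
            free? : ∀ r → Decidable (λ i → Far R i × ¬ S zero i (x r))
            free? r i = far? R i ×-dec ¬? (S? zero i (x r))
            split : ∀ r {i} → Far R i → Dec (S zero i (x r)) → Here (x r) i ⊎ (Far R i × ¬ S zero i (x r))
            split r f (yes q) = inj₁ (near f , q)
            split r f (no ¬q) = inj₂ (f , ¬q)

      impossible : 1512 < k → ∀ s → W (c s) ≡ M → ⊥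
      impossible large s heavy = <⇒≱ (from-yes (10069 <? 7 * 1513)) (≤-trans (*-monoʳ-≤ 7 large) seven-k)
        where
        open Landmark s heavy 8 (≤-trans (from-yes (7 ≤? 1513)) large)
        open ≤-Reasoning
        F N μ : ℕ
        F = # (far? 8)
        N = # heavy?
        μ = # (λ t → C? t ×-dec (W t ≟ M))
        -- If M ≥ 37, then k ≤ F + N + 17, 37F ≤ 16n, 8N + k ≤ n and n + 3 ≤ 2k, taken with weights
        -- 296, 8, 37 and 165, give 3k ≤ 4537, which fails for k ≥ 1513.
        M≤36 : M ≤ 36
        M≤36 = ≮⇒≥ λ 36<M → <⇒≱ (from-yes (4537 <? 3 * 1513)) (≤-trans (*-monoʳ-≤ 3 large) (three-k 36<M))
          where
          three-k : 36 < M → 3 * k ≤ 4537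
          three-k 36<M = +-cancelˡ-≤ (330 * k + 296 * F + 296 * N + 165 * n + 495) _ _ (begin
            330 * k + 296 * F + 296 * N + 165 * n + 495 + 3 * k       ≡⟨ lhs k F N n ⟩
            296 * k + 8 * (F * 37) + 37 * (N * 8 + k) + 165 * (3 + n)
              ≤⟨ +-mono-≤ (+-mono-≤ (+-mono-≤ (*-monoʳ-≤ 296 (k≤far 8))
                                                                          (*-monoʳ-≤ 8 (≤-trans (*-monoʳ-≤ F 36<M) #far*M≤16n))) (*-monoʳ-≤ 37 #heavy)) (*-monoʳ-≤ 165 half) ⟩
            296 * (F + (N + 17)) + 8 * (n * 16) + 37 * n + 165 * (k + k) ≡⟨ rhs k F N n ⟩
            330 * k + 296 * F + 296 * N + 165 * n + 495 + 4537        ∎)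
            where
            lhs : ∀ k F N n → 330 * k + 296 * F + 296 * N + 165 * n + 495 + 3 * k ≡ 296 * k + 8 * (F * 37) + 37 * (N * 8 + k) + 165 * (3 + n)
            lhs = solve-∀
            rhs : ∀ k F N n → 296 * (F + (N + 17)) + 8 * (n * 16) + 37 * n + 165 * (k + k) ≡ 330 * k + 296 * F + 296 * N + 165 * n + 495 + 4537
            rhs = solve-∀
        3M<k : M * 3 < k
        3M<k = ≤-trans (s≤s (*-monoˡ-≤ 3 M≤36)) (≤-trans (from-yes (109 ≤? 1513)) large)
        -- The radius 1 + M + 8 is at most 45, so the ends account for at most 46 + 45 indices.
        k≤ : k ≤ 16 + μ * 16 + (N + 91)
        k≤ = ≤-trans (k≤far (1 + M + 8)) (+-mono-≤ (#far≤ ≤-refl) (+-monoʳ-≤ N (+-mono-≤ (s≤s R≤45) R≤45)))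
          where
          R≤45 : 1 + M + 8 ≤ 45
          R≤45 = s≤s (+-monoˡ-≤ 8 M≤36)
        k+L≤′ : k + L ≤ 73 + n
        k+L≤′ = ≤-trans k+L≤ (≤-trans (+-monoʳ-≤ (1 + n) (*-monoˡ-≤ 2 M≤36)) (≤-reflexive (cong suc (+-comm n 72))))
        -- The weights 8, 1, 128, 128 and 129 are chosen to eliminate N, μ, L and n.
        seven-k : 7 * k ≤ 10069
        seven-k = +-cancelˡ-≤ (258 * k + 8 * N + 128 * μ + 128 * L + 129 * n + 387) _ _ (begin
          258 * k + 8 * N + 128 * μ + 128 * L + 129 * n + 387 + 7 * k                          ≡⟨ lhs k N μ L n ⟩
          8 * k + (N * 8 + k) + 128 * (μ + k) + 128 * (k + L) + 129 * (3 + n)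
            ≤⟨ +-mono-≤ (+-mono-≤ (+-mono-≤ (+-mono-≤ (*-monoʳ-≤ 8 k≤) #heavy)
                                                                                                   (*-monoʳ-≤ 128 (#heaviest+k≤ 3M<k))) (*-monoʳ-≤ 128 k+L≤′)) (*-monoʳ-≤ 129 half) ⟩
          8 * (16 + μ * 16 + (N + 91)) + n + 128 * (2 + L) + 128 * (73 + n) + 129 * (k + k)    ≡⟨ rhs k N μ L n ⟩
          258 * k + 8 * N + 128 * μ + 128 * L + 129 * n + 387 + 10069                          ∎)
          where
          lhs : ∀ k N μ L n → 258 * k + 8 * N + 128 * μ + 128 * L + 129 * n + 387 + 7 * k ≡ 8 * k + (N * 8 + k) + 128 * (μ + k) + 128 * (k + L) + 129 * (3 + n)
          lhs = solve-∀
          rhs : ∀ k N μ L n → 8 * (16 + μ * 16 + (N + 91)) + n + 128 * (2 + L) + 128 * (73 + n) + 129 * (k + k) ≡ 258 * k + 8 * N + 128 * μ + 128 * L + 129 * n + 387 + 10069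
          rhs = solve-∀

-- Recognising forests

insert-self : ∀ {m n} (i : Fin (suc m)) (j : Fin (suc n)) π → insert i j π ⟨$⟩ʳ i ≡ j
insert-self i j π with i Fin.≟ i
... | yes _ = refl
... | no ne = ⊥-elim (ne refl)

cards : ∀ {m k} {G H : Graph (suc m)} → AtLeastCommonCards k G H → Cards k G H
cards {m} {k} {G} {H} (x , y , x-inj , y-inj , iso) = record
  { x = x ; y = y ; x-inj = x-inj ; y-inj = y-inj
  ; π = π
  ; π-x = λ i → insert-self (x i) (y i) (proj₁ (iso i))
  ; π-adj = λ i u≢ v≢ → subst₂ (λ u v → adj H (π i ⟨$⟩ʳ u) (π i ⟨$⟩ʳ v) ≡ adj G u v)
      (Fin.punchIn-punchOut (u≢ ∘ sym)) (Fin.punchIn-punchOut (v≢ ∘ sym)) (on-card i _ _)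
  }
  where
  π : Fin k → Permutation′ (suc m)
  π i = insert (x i) (y i) (proj₁ (iso i))
  on-card : ∀ i u v → adj H (π i ⟨$⟩ʳ punchIn (x i) u) (π i ⟨$⟩ʳ punchIn (x i) v) ≡ adj G (punchIn (x i) u) (punchIn (x i) v)
  on-card i u v = trans (cong₂ (adj H) (insert-punchIn (x i) (y i) _ u) (insert-punchIn (x i) (y i) _ v)) (proj₂ (iso i) u v)

theorem2 : (m : ℕ) → 5000 ≤ suc m → (G H : Graph (suc m)) →
    IsForest G → AtLeastCommonCards ((suc m / 2) + 2) G H → IsForest H
theorem2 m 5000≤n G H forest common cyc =
  -- The goal is ⊥, so reachability may be taken to be decidable.
  ¬¬-∀ (λ _ → ¬¬-Dec) λ root? →
  ¬¬-∀ (λ _ → ¬¬-Dec) λ G₀? → finish root? G₀?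
  where
  k : ℕ
  k = suc m / 2 + 2
  D : Cards k G H
  D = cards common
  cw : ClosedWalk H
  cw = fromCycle cyc
  2500≤n/2 : 2500 ≤ suc m / 2
  2500≤n/2 = /-monoˡ-≤ 2 5000≤n
  1512<k : 1512 < k
  1512<k = ≤-trans (from-yes (1513 ≤? 2500)) (≤-trans 2500≤n/2 (m≤m+n (suc m / 2) 2))
  2<k : 2 < k
  2<k = ≤-trans (from-yes (3 ≤? 1513)) 1512<k
  -- The remainder modulo 2 is at most 1, so n ≤ 2(k - 2) + 1.
  half : 3 + suc m ≤ k + k
  half = begin
    3 + suc m                        ≡⟨ cong (3 +_) (m≡m%n+[m/n]*n (suc m) 2) ⟩
    3 + (suc m % 2 + suc m / 2 * 2)      ≤⟨ +-monoʳ-≤ 3 (+-monoˡ-≤ (suc m / 2 * 2) (≤-pred (m%n<n (suc m) 2))) ⟩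
    3 + (1 + suc m / 2 * 2)          ≡⟨ eq (suc m / 2) ⟩
    k + k                        ∎
    where
    open ≤-Reasoning
    eq : ∀ q → 3 + (1 + q * 2) ≡ (q + 2) + (q + 2)
    eq = solve-∀
  finish : ∀ root? G₀? → ⊥
  finish root? G₀? = go (h <? g)
    where
    open Pieces forest D 2<k half cw root?
    open Component G₀?
    go : Dec (h < g) → ⊥
    go (yes h<g) = Larger.impossible h<g (≤-trans (from-yes (223 ≤? 1513)) 1512<k)
    -- The landmark is a heaviest vertex among the offsets below L, which exhaust C.
    go (no h≮g) = let (t , top) = argmax (<-trans (s≤s z≤n) 2<L) (λ t → W (c (toℕ t))) in
      Tight.impossible (≮⇒≥ h≮g) (W (c (toℕ t)))
        (λ u∈ → ≤-trans (≤-reflexive (cong W (trans (sym (c-pos 0 u∈)) (cong c (sym (Fin.toℕ-fromℕ< (pos<L 0 u∈)))))))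
                  (top (fromℕ< (pos<L 0 u∈))))
        1512<k (toℕ t) refl
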